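{- Let $\rho_{\mathit{disj}}$ be the uniform distribution on $\{(0,0),(0,1),(1,0)\}\subset\{0,1\}\times\{0,1\}$. Then, as $n\to\infty$, $$\mathrm{col}_{\rho_{\mathit{disj}}}(n)=O\bigl(n^{\log_6 2}\bigr)\quad\text{and}\quad \mathrm{col}_{\rho_{\mathit{disj}}}(n)=\Omega\bigl(n^{1/4}\bigr);$$ in particular $\mathrm{col}_{\rho_{\mathit{disj}}}(n)$ is $O(n^{0.387})$ and $\Omega(n^{0.25})$.
   Context: Collision complexity. For a probability distribution $\rho$ on $U\times V$, a $p$-collision protocol for $\rho$ with domain size $n$ consists of $\ell\in\mathbb{N}$ and maps $A\colon U^\ell\to\mathcal P([n])$, $B\colon V^\ell\to\mathcal P([n])$ (possibly randomised using private independent randomness) such that $\Pr_{(\vec u,\vec v)\sim\rho^{\otimes\ell}}[i\in A(\vec u)\cap B(\vec v)]\ge p$ for every $i\in[n]$. Its output size is the maximum possible value of $\max\{|A(\vec u)|,|B(\vec v)|\}$. $\mathrm{col}_\rho(n,p)$ is the infimum of the output size over all $p$-collision protocols for $\rho$ with domain size $n$, and $\mathrm{col}_\rho(n)=\mathrm{col}_\rho(n,1/n)$. -}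

module Defs where

open import Data.Bool.Base using (Bool; true; false; if_then_else_)
open import Data.Fin.Base using (Fin; zero; suc)
open import Data.Fin.Subset using (Subset; _∈_; _∩_; ∣_∣)
open import Data.Fin.Subset.Properties using (_∈?_)
open import Data.Integer.Base using (+_)
open import Data.List.Base using (List; []; _∷_; map; foldr; allFin; cartesianProduct; cartesianProductWith)
open import Data.Nat.Base as ℕ using (ℕ; zero; suc; NonZero; _⊔_)
import Data.Nat.Properties as ℕ
open import Data.Product.Base using (∃; ∃-syntax; _×_; _,_; proj₁; proj₂)
open import Data.Rational.Base as ℚ using (ℚ; 0ℚ; 1ℚ; ½)
import Data.Rational.Properties as ℚ
open import Data.Rational.Solver using (module +-*-Solver)
open import Data.Vec.Base using (Vec; []; _∷_)
open import Relation.Binary.PropositionalEquality using (_≡_; refl; sym; trans; cong; cong₂; subst)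
open import Relation.Nullary.Decidable.Core using (does)

------------------------------------------------------------------------
-- Real numbers, as Cauchy sequences of rationals

Eventually : (ℕ → Set) → Set
Eventually P = ∃[ N ] ∀ n → N ℕ.≤ n → P n

Cauchy : (ℕ → ℚ) → Set
Cauchy x = ∀ ε → 0ℚ ℚ.< ε →
  ∃[ N ] ∀ m n → N ℕ.≤ m → N ℕ.≤ n → ℚ.∣ x m ℚ.- x n ∣ ℚ.≤ ε

record ℝ : Set where
  constructor real
  field
    seq    : ℕ → ℚ
    cauchy : Cauchy seq

open ℝ public

infix 4 _≤_ _<_ _≈_

record _≤_ (x y : ℝ) : Set where
  constructor mk≤
  field
    eventually≤ : ∀ ε → 0ℚ ℚ.< ε → Eventually (λ n → seq x n ℚ.≤ seq y n ℚ.+ ε)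

record _<_ (x y : ℝ) : Set where
  constructor mk<
  field
    gap         : ℚ
    gap>0       : 0ℚ ℚ.< gap
    eventually< : Eventually (λ n → seq x n ℚ.+ gap ℚ.≤ seq y n)

_≈_ : ℝ → ℝ → Set
x ≈ y = x ≤ y × y ≤ x

private
  half-pos : ∀ {ε} → 0ℚ ℚ.< ε → 0ℚ ℚ.< ½ ℚ.* ε
  half-pos {ε} ε>0 = subst (ℚ._< ½ ℚ.* ε) (ℚ.*-zeroʳ ½) (ℚ.*-monoʳ-<-pos ½ ε>0)

  half+half : ∀ ε → ½ ℚ.* ε ℚ.+ ½ ℚ.* ε ≡ ε
  half+half ε = trans (sym (ℚ.*-distribʳ-+ ε ½ ½)) (ℚ.*-identityˡ ε)

  +-diff : ∀ a b c d → (a ℚ.+ b) ℚ.- (c ℚ.+ d) ≡ (a ℚ.- c) ℚ.+ (b ℚ.- d)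
  +-diff = solve 4 (λ a b c d → (a :+ b) :- (c :+ d) := (a :- c) :+ (b :- d)) refl
    where open +-*-Solver

  *-diff : ∀ a b c d → (a ℚ.* b) ℚ.- (c ℚ.* d) ≡ a ℚ.* (b ℚ.- d) ℚ.+ d ℚ.* (a ℚ.- c)
  *-diff = solve 4 (λ a b c d → (a :* b) :- (c :* d) := a :* (b :- d) :+ d :* (a :- c)) refl
    where open +-*-Solver

  split : ∀ a b → a ≡ (a ℚ.- b) ℚ.+ b
  split = solve 2 (λ a b → a := (a :- b) :+ b) refl
    where open +-*-Solver

  abstract
    const-cauchy : ∀ q → Cauchy (λ _ → q)
    const-cauchy q ε ε>0 = 0 , λ _ _ _ _ →
      subst (λ z → ℚ.∣ z ∣ ℚ.≤ ε) (sym (ℚ.+-inverseʳ q)) (ℚ.<⇒≤ ε>0)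

  abstract
    +-cauchy : ∀ {x y} → Cauchy x → Cauchy y → Cauchy (λ n → x n ℚ.+ y n)
    +-cauchy {x} {y} cx cy ε ε>0
      with M , p ← cx (½ ℚ.* ε) (half-pos ε>0)
         | N , q ← cy (½ ℚ.* ε) (half-pos ε>0)
      = M ⊔ N , λ m n m≥ n≥ → begin
        ℚ.∣ (x m ℚ.+ y m) ℚ.- (x n ℚ.+ y n) ∣
          ≡⟨ cong ℚ.∣_∣ (+-diff (x m) (y m) (x n) (y n)) ⟩
        ℚ.∣ (x m ℚ.- x n) ℚ.+ (y m ℚ.- y n) ∣
          ≤⟨ ℚ.∣p+q∣≤∣p∣+∣q∣ (x m ℚ.- x n) (y m ℚ.- y n) ⟩
        ℚ.∣ x m ℚ.- x n ∣ ℚ.+ ℚ.∣ y m ℚ.- y n ∣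
          ≤⟨ ℚ.+-mono-≤
               (p m n (ℕ.m⊔n≤o⇒m≤o M N m≥) (ℕ.m⊔n≤o⇒m≤o M N n≥))
               (q m n (ℕ.m⊔n≤o⇒n≤o M N m≥) (ℕ.m⊔n≤o⇒n≤o M N n≥)) ⟩
        ½ ℚ.* ε ℚ.+ ½ ℚ.* ε
          ≡⟨ half+half ε ⟩
        ε ∎
      where open ℚ.≤-Reasoning

  0<1 : 0ℚ ℚ.< 1ℚ
  0<1 = ℚ.positive⁻¹ 1ℚ

  bounded : ∀ {x} → Cauchy x →
    ∃[ B ] 0ℚ ℚ.< B × Eventually (λ n → ℚ.∣ x n ∣ ℚ.≤ B)
  bounded {x} cx with N , p ← cx 1ℚ 0<1
    = 1ℚ ℚ.+ ℚ.∣ x N ∣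
    , ℚ.+-mono-<-≤ 0<1 (ℚ.0≤∣p∣ (x N))
    , N , λ n n≥ → begin
      ℚ.∣ x n ∣                       ≡⟨ cong ℚ.∣_∣ (split (x n) (x N)) ⟩
      ℚ.∣ (x n ℚ.- x N) ℚ.+ x N ∣     ≤⟨ ℚ.∣p+q∣≤∣p∣+∣q∣ (x n ℚ.- x N) (x N) ⟩
      ℚ.∣ x n ℚ.- x N ∣ ℚ.+ ℚ.∣ x N ∣ ≤⟨ ℚ.+-monoˡ-≤ ℚ.∣ x N ∣ (p n N n≥ ℕ.≤-refl) ⟩
      1ℚ ℚ.+ ℚ.∣ x N ∣                ∎
    where open ℚ.≤-Reasoning

  quotient : ∀ {B ε} → 0ℚ ℚ.< B → 0ℚ ℚ.< ε → ∃[ δ ] 0ℚ ℚ.< δ × B ℚ.* δ ≡ ε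
  quotient {B} {ε} B>0 ε>0 = B⁻¹ ℚ.* ε , pos , eq
    where
    instance
      B-pos : ℚ.Positive B
      B-pos = ℚ.positive B>0
      B-nz : ℚ.NonZero B
      B-nz = ℚ.pos⇒nonZero B
    B⁻¹ = ℚ.1/ B
    instance
      B⁻¹-pos : ℚ.Positive B⁻¹
      B⁻¹-pos = ℚ.1/pos⇒pos B
    pos : 0ℚ ℚ.< B⁻¹ ℚ.* ε
    pos = subst (ℚ._< B⁻¹ ℚ.* ε) (ℚ.*-zeroʳ B⁻¹) (ℚ.*-monoʳ-<-pos B⁻¹ ε>0)
    eq : B ℚ.* (B⁻¹ ℚ.* ε) ≡ ε
    eq = trans (sym (ℚ.*-assoc B B⁻¹ ε))
           (trans (cong (ℚ._* ε) (ℚ.*-inverseʳ B)) (ℚ.*-identityˡ ε))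

  ∣*∣-mono : ∀ {a b B δ} → 0ℚ ℚ.< B → ℚ.∣ a ∣ ℚ.≤ B → ℚ.∣ b ∣ ℚ.≤ δ →
    ℚ.∣ a ℚ.* b ∣ ℚ.≤ B ℚ.* δ
  ∣*∣-mono {a} {b} {B} {δ} B>0 a≤ b≤ = begin
    ℚ.∣ a ℚ.* b ∣         ≡⟨ ℚ.∣p*q∣≡∣p∣*∣q∣ a b ⟩
    ℚ.∣ a ∣ ℚ.* ℚ.∣ b ∣   ≤⟨ ℚ.*-monoʳ-≤-nonNeg ℚ.∣ b ∣ {{ℚ.∣-∣-nonNeg b}} a≤ ⟩
    B ℚ.* ℚ.∣ b ∣         ≤⟨ ℚ.*-monoˡ-≤-nonNeg B {{ℚ.pos⇒nonNeg B {{ℚ.positive B>0}}}} b≤ ⟩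
    B ℚ.* δ               ∎
    where open ℚ.≤-Reasoning

  product-bound : ∀ a b c d {B D δ η} → 0ℚ ℚ.< B → 0ℚ ℚ.< D →
    ℚ.∣ a ∣ ℚ.≤ B → ℚ.∣ d ∣ ℚ.≤ D → ℚ.∣ b ℚ.- d ∣ ℚ.≤ δ → ℚ.∣ a ℚ.- c ∣ ℚ.≤ η →
    ℚ.∣ (a ℚ.* b) ℚ.- (c ℚ.* d) ∣ ℚ.≤ B ℚ.* δ ℚ.+ D ℚ.* η
  product-bound a b c d {B} {D} {δ} {η} B>0 D>0 a≤ d≤ b-d≤ a-c≤ = begin
    ℚ.∣ (a ℚ.* b) ℚ.- (c ℚ.* d) ∣
      ≡⟨ cong ℚ.∣_∣ (*-diff a b c d) ⟩
    ℚ.∣ a ℚ.* (b ℚ.- d) ℚ.+ d ℚ.* (a ℚ.- c) ∣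
      ≤⟨ ℚ.∣p+q∣≤∣p∣+∣q∣ (a ℚ.* (b ℚ.- d)) (d ℚ.* (a ℚ.- c)) ⟩
    ℚ.∣ a ℚ.* (b ℚ.- d) ∣ ℚ.+ ℚ.∣ d ℚ.* (a ℚ.- c) ∣
      ≤⟨ ℚ.+-mono-≤ (∣*∣-mono {a} {b ℚ.- d} {B} {δ} B>0 a≤ b-d≤)
                    (∣*∣-mono {d} {a ℚ.- c} {D} {η} D>0 d≤ a-c≤) ⟩
    B ℚ.* δ ℚ.+ D ℚ.* η ∎
    where open ℚ.≤-Reasoning

  abstract
    *-cauchy : ∀ {x y} → Cauchy x → Cauchy y → Cauchy (λ n → x n ℚ.* y n)
    *-cauchy {x} {y} cx cy ε ε>0 =
      let B , B>0 , K , x≤B = bounded cx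
          D , D>0 , L , y≤D = bounded cy
          δ , δ>0 , Bδ = quotient {B} B>0 (half-pos ε>0)
          η , η>0 , Dη = quotient {D} D>0 (half-pos ε>0)
          M , q = cy δ δ>0
          N , p = cx η η>0
          KL = K ⊔ L
          MN = M ⊔ N
      in KL ⊔ MN , λ m n m≥ n≥ →
        let m≥KL = ℕ.m⊔n≤o⇒m≤o KL MN m≥
            n≥KL = ℕ.m⊔n≤o⇒m≤o KL MN n≥
            m≥MN = ℕ.m⊔n≤o⇒n≤o KL MN m≥
            n≥MN = ℕ.m⊔n≤o⇒n≤o KL MN n≥
        in subst (ℚ.∣ (x m ℚ.* y m) ℚ.- (x n ℚ.* y n) ∣ ℚ.≤_)
             (trans (cong₂ ℚ._+_ Bδ Dη) (half+half ε))
             (product-bound (x m) (y m) (x n) (y n) {B} {D} {δ} {η} B>0 D>0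
               (x≤B m (ℕ.m⊔n≤o⇒m≤o K L m≥KL)) (y≤D n (ℕ.m⊔n≤o⇒n≤o K L n≥KL))
               (q m n (ℕ.m⊔n≤o⇒m≤o M N m≥MN) (ℕ.m⊔n≤o⇒m≤o M N n≥MN))
               (p m n (ℕ.m⊔n≤o⇒n≤o M N m≥MN) (ℕ.m⊔n≤o⇒n≤o M N n≥MN)))

fromℚ : ℚ → ℝ
fromℚ q = real (λ _ → q) (const-cauchy q)

0ℝ 1ℝ : ℝ
0ℝ = fromℚ 0ℚ
1ℝ = fromℚ 1ℚ

infixl 6 _+_
infixl 7 _*_

_+_ : ℝ → ℝ → ℝ
x + y = real (λ n → seq x n ℚ.+ seq y n) (+-cauchy {seq x} {seq y} (cauchy x) (cauchy y))

_*_ : ℝ → ℝ → ℝ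
x * y = real (λ n → seq x n ℚ.* seq y n) (*-cauchy {seq x} {seq y} (cauchy x) (cauchy y))

fromℚ-mono-≤ : ∀ {p q} → p ℚ.≤ q → fromℚ p ≤ fromℚ q
fromℚ-mono-≤ {p} {q} p≤q = mk≤ λ ε ε>0 → 0 , λ _ _ →
  subst (ℚ._≤ q ℚ.+ ε) (ℚ.+-identityʳ p)
    (ℚ.+-mono-≤ {p} {q} {0ℚ} {ε} p≤q (ℚ.<⇒≤ ε>0))

∑ : {A : Set} → List A → (A → ℝ) → ℝ
∑ xs f = foldr _+_ 0ℝ (map f xs)

------------------------------------------------------------------------
-- Finite probability distributions

vectors : {A : Set} → List A → ∀ n → List (Vec A n)
vectors xs zero    = [] ∷ []
vectors xs (suc n) = cartesianProductWith _∷_ xs (vectors xs n)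

subsets : ∀ n → List (Subset n)
subsets = vectors (true ∷ false ∷ [])

-- The list xs is meant to enumerate every element of A exactly once.
record Distribution {A : Set} (xs : List A) : Set where
  field
    mass    : A → ℝ
    nonNeg  : ∀ x → 0ℝ ≤ mass x
    total   : ∑ xs mass ≈ 1ℝ

open Distribution public

JointDistribution : ℕ → ℕ → Set
JointDistribution a b = Distribution (cartesianProduct (allFin a) (allFin b))

-- The mass function of ρ^{⊗ℓ}.
tensor : ∀ {a b} → JointDistribution a b → ∀ {ℓ} → Vec (Fin a) ℓ → Vec (Fin b) ℓ → ℝ
tensor ρ []       []       = 1ℝ
tensor ρ (x ∷ us) (y ∷ vs) = mass ρ (x , y) * tensor ρ us vs

-- The uniform distribution on {(0,0),(0,1),(1,0)}.
ρ-disj : JointDistribution 2 2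
ρ-disj = record { mass = μ ; nonNeg = μ≥0 ; total = sum≤1 , 1≤sum }
  where
  μ : Fin 2 × Fin 2 → ℝ
  μ (suc zero , suc zero) = 0ℝ
  μ (zero     , _       ) = fromℚ (+ 1 ℚ./ 3)
  μ (suc zero , zero    ) = fromℚ (+ 1 ℚ./ 3)

  1≤1 : 1ℝ ≤ 1ℝ
  1≤1 = fromℚ-mono-≤ {1ℚ} {1ℚ} ℚ.≤-refl

  sum≤1 : ∑ (cartesianProduct (allFin 2) (allFin 2)) μ ≤ 1ℝ
  sum≤1 = mk≤ (_≤_.eventually≤ 1≤1)

  1≤sum : 1ℝ ≤ ∑ (cartesianProduct (allFin 2) (allFin 2)) μ
  1≤sum = mk≤ (_≤_.eventually≤ 1≤1)

  μ≥0 : ∀ x → 0ℝ ≤ μ x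
  μ≥0 (zero     , zero    ) = fromℚ-mono-≤ {0ℚ} {+ 1 ℚ./ 3} (ℚ.nonNegative⁻¹ (+ 1 ℚ./ 3))
  μ≥0 (zero     , suc zero) = fromℚ-mono-≤ {0ℚ} {+ 1 ℚ./ 3} (ℚ.nonNegative⁻¹ (+ 1 ℚ./ 3))
  μ≥0 (suc zero , zero    ) = fromℚ-mono-≤ {0ℚ} {+ 1 ℚ./ 3} (ℚ.nonNegative⁻¹ (+ 1 ℚ./ 3))
  μ≥0 (suc zero , suc zero) = fromℚ-mono-≤ {0ℚ} {0ℚ} ℚ.≤-refl

------------------------------------------------------------------------
-- Collision protocols

-- A map X → 𝒫([n]) using private randomness, given by the law of its random
-- value at each input.  As 𝒫([n]) is finite, this covers arbitrary sources of
-- randomness.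
RandomisedMap : Set → ℕ → Set
RandomisedMap X n = X → Distribution (subsets n)

-- Pr_{(u,v) ∼ ρ^{⊗ℓ}} [ i ∈ A(u) ∩ B(v) ]; the randomness of A, that of B and
-- the sample are independent, so the joint mass is a product.
collisionProbability : ∀ {a b n} → JointDistribution a b → (ℓ : ℕ) →
  RandomisedMap (Vec (Fin a) ℓ) n → RandomisedMap (Vec (Fin b) ℓ) n → Fin n → ℝ
collisionProbability {a} {b} {n} ρ ℓ A B i =
  ∑ (vectors (allFin a) ℓ) λ u → ∑ (vectors (allFin b) ℓ) λ v →
  ∑ (subsets n) λ S → ∑ (subsets n) λ T →
    tensor ρ u v * (mass (A u) S * mass (B v) T)
      * (if does (i ∈? (S ∩ T)) then 1ℝ else 0ℝ)

record Protocol {a b} (ρ : JointDistribution a b) (n : ℕ) (p : ℝ) : Set where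
  field
    ℓ         : ℕ
    A         : RandomisedMap (Vec (Fin a) ℓ) n
    B         : RandomisedMap (Vec (Fin b) ℓ) n
    collision : ∀ i → p ≤ collisionProbability ρ ℓ A B i

IsMaximum : (ℕ → Set) → ℕ → Set
IsMaximum P m = P m × (∀ k → P k → k ℕ.≤ m)

LowerBound : (ℕ → Set) → ℕ → Set
LowerBound P m = ∀ k → P k → m ℕ.≤ k

-- The empty set has no infimum in this sense (its infimum is ∞).
IsInfimum : (ℕ → Set) → ℕ → Set
IsInfimum P m = LowerBound P m × (∀ k → LowerBound P k → k ℕ.≤ m)

module _ {a b} {ρ : JointDistribution a b} {n : ℕ} {p : ℝ} where

  -- The possible values of max{|A(u)|,|B(v)|}: a value of a randomised map is
  -- possible when it has positive probability.
  PossibleSize : Protocol ρ n p → ℕ → Set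
  PossibleSize P k = ∃[ u ] ∃[ v ] ∃[ S ] ∃[ T ]
    0ℝ < mass (A u) S × 0ℝ < mass (B v) T × k ≡ ∣ S ∣ ⊔ ∣ T ∣
    where open Protocol P

  OutputSize : Protocol ρ n p → ℕ → Set
  OutputSize P = IsMaximum (PossibleSize P)

-- IsCol ρ n p c says that col_ρ(n,p) = c.
IsCol : ∀ {a b} → JointDistribution a b → ℕ → ℝ → ℕ → Set
IsCol ρ n p = IsInfimum (λ s → ∃[ P ] OutputSize {ρ = ρ} {n} {p} P s)

-- col-disj n c says that col_{ρ_disj}(n) = c.
col-disj : (n : ℕ) → .{{NonZero n}} → ℕ → Set
col-disj n = IsCol ρ-disj n (fromℚ (+ 1 ℚ./ n))

------------------------------------------------------------------------
-- Powers with real exponents, and asymptotics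

-- A non-negative real exponent α, given by its comparison with fractions:
-- Below p q means p / q ≤ α, and Above p q means α ≤ p / q.
record Exponent : Set₁ where
  field
    Below Above : (p q : ℕ) → .{{NonZero q}} → Set

open Exponent public

infix 8 _//_

_//_ : (a b : ℕ) → .{{NonZero b}} → Exponent
(a // b) .Below p q = p ℕ.* b ℕ.≤ a ℕ.* q
(a // b) .Above p q = a ℕ.* q ℕ.≤ p ℕ.* b

-- log b x is the logarithm of x to base b, for b > 1 and x ≥ 1.
log : ℕ → ℕ → Exponent
log b x .Below p q = b ℕ.^ p ℕ.≤ x ℕ.^ q
log b x .Above p q = x ℕ.^ q ℕ.≤ b ℕ.^ p

-- c ≤ K n^α and n^α ≤ K c.  For n ≥ 1, n^α is the infimum of n^{p/q} over
-- p/q ≥ α and the supremum of n^{p/q} over p/q ≤ α; the inequalities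
-- c ≤ K n^{p/q} and n^{p/q} ≤ K c are raised to the power q.
AtMost : (c K n : ℕ) → Exponent → Set
AtMost c K n α = ∀ p q .{{_ : NonZero q}} → Above α p q →
  c ℕ.^ q ℕ.≤ K ℕ.^ q ℕ.* n ℕ.^ p

AtLeast : (c K n : ℕ) → Exponent → Set
AtLeast c K n α = ∀ p q .{{_ : NonZero q}} → Below α p q →
  n ℕ.^ p ℕ.≤ (K ℕ.* c) ℕ.^ q

-- A function of n ≥ 1 with values in ℕ, given by its graph.
Graph : Set₁
Graph = (n : ℕ) → .{{NonZero n}} → ℕ → Set

-- f(n) = O(n^α) and f(n) = Ω(n^α).  Natural constants suffice: any positive
-- real is at most some K and at least some 1 / K.
IsO IsΩ : Graph → Exponent → Set
IsO f α = ∃[ K ] ∃[ n₀ ] ∀ n .{{_ : NonZero n}} → n₀ ℕ.≤ n → ∀ c → f n c → AtMost c K n α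
IsΩ f α = ∃[ K ] ∃[ n₀ ] ∀ n .{{_ : NonZero n}} → n₀ ℕ.≤ n → ∀ c → f n c → AtLeast c K n α

{-# OPTIONS --safe #-}

-- Upper bound.  On four samples both players can name a symbol of a
-- three-letter alphabet so that each symbol is named by both with probability
-- at least 1/6.  On 4k samples they name a word of length k, each of the 3^k
-- words being agreed on with probability at least 6^-k; spreading [n], with
-- 6^k ≤ n < 6^(k+1), evenly over the words gives outputs of size O(2^k).
--
-- Lower bound.  For f, g with values in [0,1], hypercontractivity gives
-- E[f(u) g(v)] ≤ E[f]^(2/3) E[g]^(2/3).  Apply it to f(u) = Pr[i ∈ A(u)] and
-- g(v) = Pr[i ∈ B(v)] for an i at which both means are O(s/n), s being the
-- output size: 1/n = O((s/n)^(4/3)).  Over ℚ the cube roots are replaced by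
-- arbitrary y, z with E[f] < y³ and E[g] < z³, the conclusion being
-- E[f g] ≤ y² z²; the real masses of a protocol enter through rational
-- approximations.

module Submission where

open import Defs renaming (_≤_ to _≤ℝ_; _<_ to _<ℝ_; _+_ to _+ℝ_; _*_ to _*ℝ_)
open import Data.Bool.Base using (Bool; true; false; _∧_; if_then_else_)
import Data.Bool.Properties as Bool
open import Data.Fin.Base using (Fin; zero; suc; punchOut; quotient; remainder; combine; inject≤)
import Data.Fin.Properties as Fin
open import Data.Fin.Subset using (Subset; _∈_; _∩_; ∣_∣)
open import Data.Fin.Subset.Properties using (_∈?_; ∣p∣≤n)
open import Data.Integer.Base as ℤ using (+_; -[1+_])
import Data.Integer.Properties as ℤ
open import Data.List.Base using (List; []; _∷_; _++_; map; foldr; allFin; length; cartesianProductWith)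
open import Data.List.Properties using (map-tabulate)
open import Data.Nat.Base as ℕ using (ℕ; zero; suc; NonZero)
open import Data.Nat.Induction using (<-rec)
import Data.Nat.Properties as ℕ
import Data.Nat.Solver
open import Data.Product.Base using (∃; ∃-syntax; _×_; _,_; proj₁; proj₂)
open import Data.Rational.Base as ℚ hiding (truncate; nonNeg; ∣_∣; NonZero)
open import Data.Rational.Properties
open import Data.Rational.Solver using (module +-*-Solver)
open import Data.Rational.Unnormalised.Base as ℚᵘ using (mkℚᵘ; *≡*; *≤*)
import Data.Rational.Unnormalised.Properties as ℚᵘ
open import Data.Sum.Base using (inj₁; inj₂)
open import Data.Vec.Base as Vec using (Vec; []; _∷_; replicate; take; drop; here; there)
open import Data.Vec.Properties using (≡-dec; ∷-injective; lookup∘tabulate; []=⇒lookup)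
open import Function.Base using (_∘_)
open import Relation.Binary.PropositionalEquality
open import Relation.Nullary using (¬_; Dec; yes; no; contradiction; does)
open import Relation.Nullary.Decidable using (toWitness; decidable-stable)

open +-*-Solver using (solve; con; _:+_; _:*_; _:-_; _:=_)

-- The exponent 2/3 is dictated by a single sample. Under `ρ-disj` the two bits have correlation
-- coefficient -1/2, and near constant functions a bound by norms of order p needs p - 1 ≥ 1/2. So p
-- = 3/2, and for values in [0,1] the norm of order 3/2 is at most the mean to the power 2/3. The
-- bound passes to many samples by induction because the two-point inequality composes with itself.
-- Two obstacles come from the reals being Cauchy sequences. Whether a mass is positive cannot be
-- decided, so the maximal output size and the infimum exist only under double negation; but every
-- inequality finally extracted is between natural numbers, hence decidable and stable. Also, a mass
-- that is not positive is merely small at late indices, and a nonnegative one may be slightly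
-- negative there. The lower bound is therefore proved for rational weights read off at one common
-- index and shifted upwards, and its constants absorb the errors.

module ℕ-Solver = Data.Nat.Solver.+-*-Solver

private variable
  X Y : Set

-- Ordered-field facts

+-nonNeg : ∀ {p q} → 0ℚ ≤ p → 0ℚ ≤ q → 0ℚ ≤ p + q
+-nonNeg = +-mono-≤ {0ℚ} {_} {0ℚ}

*-mono : ∀ {p q r s} → 0ℚ ≤ q → 0ℚ ≤ r → p ≤ q → r ≤ s → p * r ≤ q * s
*-mono {q = q} {r} 0≤q 0≤r p≤q r≤s = ≤-trans
  (*-monoʳ-≤-nonNeg r {{nonNegative 0≤r}} p≤q)
  (*-monoˡ-≤-nonNeg q {{nonNegative 0≤q}} r≤s)

*-nonNeg : ∀ {p q} → 0ℚ ≤ p → 0ℚ ≤ q → 0ℚ ≤ p * q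
*-nonNeg {p} {q} 0≤p 0≤q =
  subst (_≤ p * q) (*-zeroʳ p) (*-monoˡ-≤-nonNeg p {{nonNegative 0≤p}} 0≤q)

square-nonNeg : ∀ p → 0ℚ ≤ p * p
square-nonNeg p with ≤-total 0ℚ p
... | inj₁ 0≤p = *-nonNeg 0≤p 0≤p
... | inj₂ p≤0 = subst (0ℚ ≤_)
  (solve 1 (λ p → (con 0ℚ :- p) :* (con 0ℚ :- p) := p :* p) refl p)
  (*-nonNeg 0≤-p 0≤-p)
  where
  0≤-p : 0ℚ ≤ 0ℚ - p
  0≤-p = subst (_≤ 0ℚ - p) (+-inverseʳ p) (+-monoˡ-≤ (- p) p≤0)

≤-by-difference : ∀ {p q} d → 0ℚ ≤ d → p + d ≡ q → p ≤ q
≤-by-difference {p} d 0≤d refl =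
  subst (_≤ p + d) (+-identityʳ p) (+-monoʳ-≤ p 0≤d)

difference-pos : ∀ {p q} → p < q → 0ℚ < q - p
difference-pos {p} {q} p<q =
  subst (_< q - p) (+-inverseʳ p) (+-monoˡ-< (- p) p<q)

*-pos : ∀ {p q} → 0ℚ < p → 0ℚ < q → 0ℚ < p * q
*-pos {p} {q} 0<p 0<q =
  subst (_< p * q) (*-zeroʳ p) (*-monoʳ-<-pos p {{positive 0<p}} 0<q)

cube : ℚ → ℚ
cube p = p * p * p

cube-nonNeg : ∀ {p} → 0ℚ ≤ p → 0ℚ ≤ cube p
cube-nonNeg 0≤p = *-nonNeg (*-nonNeg 0≤p 0≤p) 0≤p

cube-mono-≤ : ∀ {p q} → 0ℚ ≤ p → p ≤ q → cube p ≤ cube q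
cube-mono-≤ 0≤p p≤q = *-mono (*-nonNeg 0≤q 0≤q) 0≤p (*-mono 0≤q 0≤p p≤q p≤q) p≤q
  where 0≤q = ≤-trans 0≤p p≤q

cube-mono-< : ∀ {p q} → 0ℚ ≤ p → p < q → cube p < cube q
cube-mono-< {p} {q} 0≤p p<q = ≤-<-trans
  (*-mono (*-nonNeg 0≤q 0≤q) 0≤p (*-mono 0≤q 0≤p p≤q p≤q) ≤-refl)
  (*-monoʳ-<-pos (q * q) {{positive (*-pos 0<q 0<q)}} p<q)
  where
  p≤q = <⇒≤ p<q
  0<q = ≤-<-trans 0≤p p<q
  0≤q = <⇒≤ 0<q

cube-cancel-≤ : ∀ {p q} → 0ℚ ≤ q → cube p ≤ cube q → p ≤ q
cube-cancel-≤ {p} {q} 0≤q p³≤q³ with p ≤? q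
... | yes p≤q = p≤q
... | no  p≰q = contradiction (<-≤-trans (cube-mono-< 0≤q (≰⇒> p≰q)) p³≤q³) (<-irrefl refl)

-- Natural numbers as rationals

ι : ℕ → ℚ
ι n = + n / 1

toℚᵘ-ι : ∀ n → toℚᵘ (ι n) ℚᵘ.≃ mkℚᵘ (+ n) 0
toℚᵘ-ι n = toℚᵘ-fromℚᵘ (mkℚᵘ (+ n) 0)

ι-+ : ∀ m n → ι (m ℕ.+ n) ≡ ι m + ι n
ι-+ m n = toℚᵘ-injective (ℚᵘ.≃-trans (toℚᵘ-ι (m ℕ.+ n)) (ℚᵘ.≃-sym
  (ℚᵘ.≃-trans (toℚᵘ-homo-+ (ι m) (ι n))
  (ℚᵘ.≃-trans (ℚᵘ.+-cong (toℚᵘ-ι m) (toℚᵘ-ι n))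
    (*≡* (cong (ℤ._* + 1) (cong₂ ℤ._+_ (ℤ.*-identityʳ (+ m)) (ℤ.*-identityʳ (+ n)))))))))

ι-* : ∀ m n → ι (m ℕ.* n) ≡ ι m * ι n
ι-* m n = toℚᵘ-injective (ℚᵘ.≃-trans (toℚᵘ-ι (m ℕ.* n)) (ℚᵘ.≃-sym
  (ℚᵘ.≃-trans (toℚᵘ-homo-* (ι m) (ι n))
  (ℚᵘ.≃-trans (ℚᵘ.*-cong (toℚᵘ-ι m) (toℚᵘ-ι n))
    (*≡* (cong (ℤ._* + 1) (sym (ℤ.pos-* m n))))))))

ι-mono-≤ : ∀ {m n} → m ℕ.≤ n → ι m ≤ ι n
ι-mono-≤ {m} {n} m≤n = toℚᵘ-cancel-≤
  (ℚᵘ.≤-respˡ-≃ (ℚᵘ.≃-sym (toℚᵘ-ι m)) (ℚᵘ.≤-respʳ-≃ (ℚᵘ.≃-sym (toℚᵘ-ι n))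
    (*≤* (ℤ.*-monoʳ-≤-nonNeg (+ 1) (ℤ.+≤+ m≤n)))))

ι-cancel-≤ : ∀ {m n} → ι m ≤ ι n → m ℕ.≤ n
ι-cancel-≤ {m} {n} m≤n with ℚᵘ.≤-respˡ-≃ (toℚᵘ-ι m) (ℚᵘ.≤-respʳ-≃ (toℚᵘ-ι n) (toℚᵘ-mono-≤ m≤n))
... | *≤* m*1≤n*1 = ℤ.drop‿+≤+ (ℤ.*-cancelʳ-≤-pos (+ m) (+ n) (+ 1) m*1≤n*1)

ι-nonNeg : ∀ n → 0ℚ ≤ ι n
ι-nonNeg n = ι-mono-≤ {0} {n} ℕ.z≤n

ι-suc : ∀ n → ι (suc n) ≡ 1ℚ + ι n
ι-suc = ι-+ 1

1/n*ι : ∀ n .{{_ : NonZero n}} → + 1 / n * ι n ≡ 1ℚ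
1/n*ι (suc n) = toℚᵘ-injective (ℚᵘ.≃-trans (toℚᵘ-homo-* (+ 1 / suc n) (ι (suc n)))
  (ℚᵘ.≃-trans (ℚᵘ.*-cong (toℚᵘ-fromℚᵘ (mkℚᵘ (+ 1) n)) (toℚᵘ-ι (suc n)))
    (*≡* (trans (ℤ.*-identityʳ _) (sym (trans (ℤ.*-identityˡ _) (sym (ℤ.*-comm (+ 1) (+ (suc n))))))))))

-- The numerator's absolute value serves as the bound, since the denominator is at least 1.
archimedean : ∀ p → ∃[ n ] p ≤ ι n
archimedean p = ℤ.∣ ↥ p ∣ , toℚᵘ-cancel-≤ (ℚᵘ.≤-respʳ-≃ (ℚᵘ.≃-sym (toℚᵘ-ι ℤ.∣ ↥ p ∣)) (bound p))
  where
  bound : ∀ p → toℚᵘ p ℚᵘ.≤ mkℚᵘ (+ ℤ.∣ ↥ p ∣) 0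
  bound (mkℚ (+ n) d-1 _) = *≤* (ℤ.*-monoˡ-≤-nonNeg (+ n) {+ 1} {+ suc d-1} (ℤ.+≤+ (ℕ.s≤s ℕ.z≤n)))
  bound (mkℚ -[1+ n ] d-1 _) = *≤* (subst₂ ℤ._≤_ (sym (ℤ.*-identityʳ -[1+ n ]))
    (ℤ.pos-* (suc n) (suc d-1)) ℤ.-≤+)

-- The two-point inequality

module _ {x y z w : ℚ} (0≤x : 0ℚ ≤ x) (0≤y : 0ℚ ≤ y) (0≤z : 0ℚ ≤ z) (0≤w : 0ℚ ≤ w) where

  private
    three four : ℚ
    three = + 3 / 1
    four  = + 4 / 1

    C p r t a b : ℚ
    C = z * z + w * w
    p = C * y
    r = x * (z * z)
    t = cube C + four * cube (z * z)
    a = cube x + cube x + cube y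
    b = cube z + cube z + cube w

    0≤C : 0ℚ ≤ C
    0≤C = +-nonNeg (square-nonNeg z) (square-nonNeg w)

    0≤p : 0ℚ ≤ p
    0≤p = *-nonNeg 0≤C 0≤y

    0≤r : 0ℚ ≤ r
    0≤r = *-nonNeg 0≤x (square-nonNeg z)

    0≤four : 0ℚ ≤ four
    0≤four = toWitness {a? = 0ℚ ≤? four} _

    -- For fixed C and z this is sharp at C y = 2 x z².
    step₁ : four * cube (x * x * C + y * y * (z * z)) ≤ t * (a * a)
    step₁ = ≤-by-difference
      ((p - (r + r)) * (p - (r + r)) * (four * cube x * (p + r) + cube y * (p + four * r)))
      (*-nonNeg (square-nonNeg (p - (r + r)))
        (+-nonNeg (*-nonNeg (*-nonNeg 0≤four (cube-nonNeg 0≤x)) (+-nonNeg 0≤p 0≤r))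
                  (*-nonNeg (cube-nonNeg 0≤y) (+-nonNeg 0≤p (*-nonNeg 0≤four 0≤r)))))
      (solve 4 (λ x y Z C →
        let :four = con four
            :cube q = q :* q :* q
            p = C :* y
            r = x :* Z
            a = :cube x :+ :cube x :+ :cube y
            d = p :- (r :+ r)
        in :four :* :cube (x :* x :* C :+ y :* y :* Z)
             :+ d :* d :* (:four :* :cube x :* (p :+ r) :+ :cube y :* (p :+ :four :* r))
           := (:cube C :+ :four :* :cube Z) :* (a :* a))
        refl x y (z * z) C)

    -- Equality holds at `w = z`, where the function is constant. The second-order term of the
    -- difference vanishes there, which marks 3/2 as the critical exponent and lets `(w - z)⁴`
    -- factor out.
    step₂ : three * t ≤ four * (b * b)
    step₂ = ≤-by-difference
      ((w - z) * (w - z) * ((w - z) * (w - z)) * (w * w + four * (w * z) + z * z))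
      (*-nonNeg (*-nonNeg (square-nonNeg (w - z)) (square-nonNeg (w - z)))
        (+-nonNeg (+-nonNeg (square-nonNeg w) (*-nonNeg 0≤four (*-nonNeg 0≤w 0≤z))) (square-nonNeg z)))
      (solve 2 (λ z w →
        let :three = con three
            :four = con four
            :cube q = q :* q :* q
            b = :cube z :+ :cube z :+ :cube w
            d = w :- z
        in :three :* (:cube (z :* z :+ w :* w) :+ :four :* :cube (z :* z))
             :+ d :* d :* (d :* d) :* (w :* w :+ :four :* (w :* z) :+ z :* z)
           := :four :* (b :* b))
        refl z w)

  -- With `f = (x², y²)` and `g = (z², w²)` on a bit that is 0 with probability 2/3, this is the
  -- cube of E[f g] ≤ ‖f‖ ‖g‖ in the norm of order 3/2, multiplied by 81. Eliminating `x` and `y` by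
  -- Hölder (`step₁`) leaves an inequality in `z` and `w` alone (`step₂`).
  two-point-inequality :
    three * cube (x * x * (z * z + w * w) + y * y * (z * z))
      ≤ (cube x + cube x + cube y) * (cube x + cube x + cube y)
        * ((cube z + cube z + cube w) * (cube z + cube z + cube w))
  two-point-inequality = *-cancelˡ-≤-pos four (begin
    four * (three * K)        ≡⟨ swap four three K ⟩
    three * (four * K)        ≤⟨ *-monoˡ-≤-nonNeg three step₁ ⟩
    three * (t * (a * a))     ≡⟨ *-assoc three t (a * a) ⟨
    three * t * (a * a)       ≤⟨ *-monoʳ-≤-nonNeg (a * a) {{nonNegative (square-nonNeg a)}} step₂ ⟩
    four * (b * b) * (a * a)
      ≡⟨ trans (*-assoc four (b * b) (a * a)) (cong (four *_) (*-comm (b * b) (a * a))) ⟩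
    four * (a * a * (b * b))  ∎)
    where
    open ≤-Reasoning
    K = cube (x * x * C + y * y * (z * z))
    swap : ∀ p q r → p * (q * r) ≡ q * (p * r)
    swap = solve 3 (λ p q r → p :* (q :* r) := q :* (p :* r)) refl

-- Rational approximations to cube roots

0<1 : 0ℚ < 1ℚ
0<1 = toWitness {a? = 0ℚ <? 1ℚ} _

0≤1 : 0ℚ ≤ 1ℚ
0≤1 = <⇒≤ 0<1

archimedean-* : ∀ p {q} → 0ℚ < q → ∃[ n ] p ≤ q * ι (suc n)
archimedean-* p {q} 0<q =
  let n , p/q≤n = archimedean (1/q * p)
      open ≤-Reasoning
  in n , (begin
    p                ≡⟨ trans (cong (_* p) (*-inverseʳ q)) (*-identityˡ p) ⟨
    q * 1/q * p      ≡⟨ *-assoc q 1/q p ⟩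
    q * (1/q * p)    ≤⟨ *-monoˡ-≤-nonNeg q p/q≤n ⟩
    q * ι n          ≤⟨ *-monoˡ-≤-nonNeg q (ι-mono-≤ (ℕ.n≤1+n n)) ⟩
    q * ι (suc n)    ∎)
  where
  instance
    _ = positive 0<q
    _ = pos⇒nonNeg q
    _ = pos⇒nonZero q
  1/q = 1/ q

archimedean-/ : ∀ p {q} → 0ℚ < q → ∃[ n ] + 1 / suc n * p ≤ q
archimedean-/ p {q} 0<q =
  let n , p≤qn = archimedean-* p 0<q
      h = + 1 / suc n
      open ≤-Reasoning
  in n , (begin
    h * p                ≤⟨ *-monoˡ-≤-nonNeg h {{normalize-nonNeg 1 (suc n)}} p≤qn ⟩
    h * (q * ι (suc n))  ≡⟨ solve 3 (λ h q n → h :* (q :* n) := q :* (h :* n)) refl h q (ι (suc n)) ⟩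
    q * (h * ι (suc n))  ≡⟨ cong (q *_) (1/n*ι (suc n)) ⟩
    q * 1ℚ               ≡⟨ *-identityʳ q ⟩
    q                    ∎)

module _ {r : ℚ} (0≤r : 0ℚ ≤ r) where

  private
    -- In steps of length `h` from `t`, the cube starts at most `r` and exceeds it after `N` steps,
    -- so some step crosses `r`.
    scan : ∀ N {t h} → 0ℚ ≤ t → 0ℚ ≤ h → cube t ≤ r → r < cube (t + ι N * h) →
      ∃[ s ] 0ℚ ≤ s × cube s ≤ r × r < cube (s + h)
    scan zero {t} {h} 0≤t 0≤h t³≤r r< =
      contradiction (<-≤-trans r< (subst (λ s → cube s ≤ r) eq t³≤r)) (<-irrefl refl)
      where
      eq : t ≡ t + ι 0 * h
      eq = sym (trans (cong (_+_ t) (*-zeroˡ h)) (+-identityʳ t))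
    scan (suc N) {t} {h} 0≤t 0≤h t³≤r r< with r <? cube (t + h)
    ... | yes r<[t+h]³ = t , 0≤t , t³≤r , r<[t+h]³
    ... | no  r≮[t+h]³ =
      scan N (+-nonNeg 0≤t 0≤h) 0≤h (≮⇒≥ r≮[t+h]³) (subst (λ s → r < cube s) eq r<)
      where
      eq : t + ι (suc N) * h ≡ t + h + ι N * h
      eq = trans (cong (λ n → t + n * h) (ι-suc N))
        (solve 3 (λ t h n → t :+ (con 1ℚ :+ n) :* h := t :+ h :+ n :* h) refl t h (ι N))

  -- The grid point `s + h` just after the crossing works: its cube exceeds `cube s ≤ r` by `h`
  -- times a bracket of at most `D`, so a mesh with `h * D ≤ δ` suffices. `B = 1 + r` bounds the
  -- cube root of `r` from above.
  cubes-dense : ∀ {δ} → 0ℚ < δ → ∃[ t ] 0ℚ ≤ t × r < cube t × cube t ≤ r + δ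
  cubes-dense {δ} 0<δ =
    let M , hD≤δ = archimedean-/ D 0<δ
        K , B≤K = archimedean B
        h = + 1 / suc M
        0<h = positive⁻¹ h {{normalize-pos 1 (suc M)}}
        0≤h = <⇒≤ 0<h
        h≤1 = subst₂ _≤_ (*-identityʳ h) (1/n*ι (suc M))
                (*-monoˡ-≤-nonNeg h {{nonNegative 0≤h}} (ι-mono-≤ {1} {suc M} (ℕ.s≤s ℕ.z≤n)))
        -- `K * suc M` steps of length `1 / suc M` end at `K`, and `r < B ≤ cube B ≤ cube K`.
        s , 0≤s , s³≤r , r<[s+h]³ = scan (K ℕ.* suc M) {0ℚ} {h} ≤-refl 0≤h 0≤r
          (subst (λ s → r < cube s) (sym (reach K M)) (<-≤-trans r<B
            (≤-trans B≤B³ (cube-mono-≤ 0≤B B≤K))))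
    in s + h , +-nonNeg 0≤s 0≤h , r<[s+h]³ ,
       (begin
         cube (s + h)                                       ≡⟨ expand s h ⟩
         cube s + h * (s * s + s * s + s * s + (s * h + s * h + s * h) + h * h)
           ≤⟨ +-mono-≤ s³≤r (*-monoˡ-≤-nonNeg h {{nonNegative 0≤h}} (bracket 0≤s s³≤r 0≤h h≤1)) ⟩
         r + h * D                                          ≤⟨ +-monoʳ-≤ r hD≤δ ⟩
         r + δ                                              ∎)
    where
    open ≤-Reasoning
    B D : ℚ
    B = 1ℚ + r
    D = B * B + B * B + B * B + (B * 1ℚ + B * 1ℚ + B * 1ℚ) + 1ℚ * 1ℚ

    1≤B : 1ℚ ≤ B
    1≤B = ≤-by-difference r 0≤r refl

    0≤B : 0ℚ ≤ B
    0≤B = ≤-trans 0≤1 1≤B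

    r<B : r < B
    r<B = subst (_< B) (+-identityˡ r) (+-monoˡ-< r 0<1)

    B≤B³ : B ≤ cube B
    B≤B³ = subst (_≤ cube B) (*-identityˡ B)
      (*-monoʳ-≤-nonNeg B {{nonNegative 0≤B}} (*-mono 0≤B 0≤1 1≤B 1≤B))

    reach : ∀ K M → 0ℚ + ι (K ℕ.* suc M) * (+ 1 / suc M) ≡ ι K
    reach K M = trans (+-identityˡ _) (trans (cong (_* h) (ι-* K (suc M)))
      (trans (solve 3 (λ k m h → k :* m :* h := k :* (h :* m)) refl (ι K) (ι (suc M)) h)
      (trans (cong (ι K *_) (1/n*ι (suc M))) (*-identityʳ (ι K)))))
      where h = + 1 / suc M

    expand : ∀ s h → cube (s + h)
      ≡ cube s + h * (s * s + s * s + s * s + (s * h + s * h + s * h) + h * h)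
    expand = solve 2 (λ s h → (s :+ h) :* (s :+ h) :* (s :+ h) :=
      s :* s :* s :+ h :* (s :* s :+ s :* s :+ s :* s :+ (s :* h :+ s :* h :+ s :* h) :+ h :* h)) refl

    bracket : ∀ {s h} → 0ℚ ≤ s → cube s ≤ r → 0ℚ ≤ h → h ≤ 1ℚ →
      s * s + s * s + s * s + (s * h + s * h + s * h) + h * h ≤ D
    bracket {s} {h} 0≤s s³≤r 0≤h h≤1 = +-mono-≤ (+-mono-≤
        (+-mono-≤ (+-mono-≤ ss ss) ss) (+-mono-≤ (+-mono-≤ sh sh) sh)) (*-mono 0≤1 0≤h h≤1 h≤1)
      where
      s≤B : s ≤ B
      s≤B = cube-cancel-≤ 0≤B (≤-trans s³≤r (≤-trans (<⇒≤ r<B) B≤B³))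
      ss : s * s ≤ B * B
      ss = *-mono 0≤B 0≤s s≤B s≤B
      sh : s * h ≤ B * 1ℚ
      sh = *-mono 0≤B 0≤h s≤B h≤1

-- Means and correlations under ρ-disj

⅓ : ℚ
⅓ = + 1 / 3

0≤⅓ : 0ℚ ≤ ⅓
0≤⅓ = toWitness {a? = 0ℚ ≤? ⅓} _

⅓-mono : ∀ {p q} → p ≤ q → ⅓ * p ≤ ⅓ * q
⅓-mono = *-monoˡ-≤-nonNeg ⅓

-- The marginal of either player: a bit is 0 with probability 2/3. Recursion on `ℓ`, in place of a
-- sum over `vectors`, exposes the first sample to inductions; likewise for `correlation`, where the
-- pair (1,1) has mass 0.
mean : ∀ {ℓ} → (Vec (Fin 2) ℓ → ℚ) → ℚ
mean {zero}  f = f []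
mean {suc ℓ} f = ⅓ * (mean (f ∘ (zero ∷_)) + mean (f ∘ (zero ∷_)) + mean (f ∘ (suc zero ∷_)))

correlation : ∀ {ℓ} → (f g : Vec (Fin 2) ℓ → ℚ) → ℚ
correlation {zero}  f g = f [] * g []
correlation {suc ℓ} f g = ⅓ * (correlation f₀ g₀ + correlation f₀ g₁ + correlation f₁ g₀)
  where
  f₀ = f ∘ (zero ∷_)
  f₁ = f ∘ (suc zero ∷_)
  g₀ = g ∘ (zero ∷_)
  g₁ = g ∘ (suc zero ∷_)

mean-nonNeg : ∀ {ℓ} {f : Vec (Fin 2) ℓ → ℚ} → (∀ u → 0ℚ ≤ f u) → 0ℚ ≤ mean f
mean-nonNeg {zero}  0≤f = 0≤f []
mean-nonNeg {suc ℓ} 0≤f = *-nonNeg 0≤⅓ (+-nonNeg (+-nonNeg 0≤f₀ 0≤f₀) (mean-nonNeg (0≤f ∘ (suc zero ∷_))))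
  where 0≤f₀ = mean-nonNeg (0≤f ∘ (zero ∷_))

private
  module _ {α β y : ℚ} (0≤α : 0ℚ ≤ α) (0≤β : 0ℚ ≤ β) (<y³ : ⅓ * (α + α + β) < cube y) where

    -- `cube a` and `cube b` may each exceed their slice mean by the whole gap `δ`, because the
    -- weights 2/3 and 1/3 add up to 1. Strictness of the hypothesis makes `δ` positive, and it is
    -- handed on to both slices.
    split-mean : ∃[ a ] ∃[ b ] 0ℚ ≤ a × 0ℚ ≤ b × α < cube a × β < cube b ×
      ⅓ * (cube a + cube a + cube b) ≤ cube y
    split-mean =
      let δ = cube y - ⅓ * (α + α + β)
          0<δ = difference-pos <y³
          a , 0≤a , α<a³ , a³≤ = cubes-dense 0≤α 0<δ
          b , 0≤b , β<b³ , b³≤ = cubes-dense 0≤β 0<δ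
      in a , b , 0≤a , 0≤b , α<a³ , β<b³ ,
         ≤-trans (⅓-mono (+-mono-≤ (+-mono-≤ a³≤ a³≤) b³≤))
           (≤-reflexive (solve 3 (λ α β c →
              let m = con ⅓ :* (α :+ α :+ β)
                  d = c :- m
              in con ⅓ :* (α :+ d :+ (α :+ d) :+ (β :+ d)) := c) refl α β (cube y)))

  -- With `y` as a cube root of `p` this is `p ≤ p^(2/3)` on [0,1]; it is where the upper bound 1 on
  -- the values enters.
  ≤1⇒≤square : ∀ {p y} → 0ℚ ≤ y → p ≤ 1ℚ → p < cube y → p ≤ y * y
  ≤1⇒≤square {p} {y} 0≤y p≤1 p<y³ with ≤-total y 1ℚ
  ... | inj₁ y≤1 = ≤-trans (<⇒≤ p<y³) (subst (cube y ≤_) (*-identityʳ (y * y))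
    (*-monoˡ-≤-nonNeg (y * y) {{nonNegative (square-nonNeg y)}} y≤1))
  ... | inj₂ 1≤y = ≤-trans p≤1 (*-mono 0≤y 0≤1 1≤y 1≤y)

  two-point-mean : ∀ {y z a b c d} → 0ℚ ≤ y → 0ℚ ≤ z → 0ℚ ≤ a → 0ℚ ≤ b → 0ℚ ≤ c → 0ℚ ≤ d →
    ⅓ * (cube a + cube a + cube b) ≤ cube y → ⅓ * (cube c + cube c + cube d) ≤ cube z →
    ⅓ * (a * a * (c * c + d * d) + b * b * (c * c)) ≤ y * y * (z * z)
  two-point-mean {y} {z} {a} {b} {c} {d} 0≤y 0≤z 0≤a 0≤b 0≤c 0≤d ab≤ cd≤ =
    cube-cancel-≤ (*-nonNeg (square-nonNeg y) (square-nonNeg z)) (begin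
      cube (⅓ * T)
        -- 1/81 is the 1/27 from cubing `⅓` with a factor 3 taken out; as the fourth power of `⅓` it
        -- then splits over `A`, `A`, `B`, `B`.
        ≡⟨ solve 1 (λ t → :cube (con ⅓ :* t) := con 1/81 :* (con (+ 3 / 1) :* :cube t)) refl T ⟩
      1/81 * (+ 3 / 1 * cube T)   ≤⟨ *-monoˡ-≤-nonNeg 1/81 (two-point-inequality 0≤a 0≤b 0≤c 0≤d) ⟩
      1/81 * (A * A * (B * B))    ≡⟨ solve 2 (λ a b → con 1/81 :* (a :* a :* (b :* b))
                                       := (con ⅓ :* a) :* (con ⅓ :* a) :* ((con ⅓ :* b) :* (con ⅓ :* b))) refl A B ⟩
      ⅓ * A * (⅓ * A) * (⅓ * B * (⅓ * B))
        ≤⟨ *-mono (square-nonNeg (cube y)) (square-nonNeg (⅓ * B))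
             (*-mono (cube-nonNeg 0≤y) 0≤A ab≤ ab≤) (*-mono (cube-nonNeg 0≤z) 0≤B cd≤ cd≤) ⟩
      cube y * cube y * (cube z * cube z)
        ≡⟨ solve 2 (λ y z → :cube y :* :cube y :* (:cube z :* :cube z) := :cube (y :* y :* (z :* z))) refl y z ⟩
      cube (y * y * (z * z))      ∎)
    where
    open ≤-Reasoning
    1/81 T A B : ℚ
    1/81 = + 1 / 81
    T = a * a * (c * c + d * d) + b * b * (c * c)
    A = cube a + cube a + cube b
    B = cube c + cube c + cube d
    0≤A : 0ℚ ≤ ⅓ * A
    0≤A = *-nonNeg 0≤⅓ (+-nonNeg (+-nonNeg (cube-nonNeg 0≤a) (cube-nonNeg 0≤a)) (cube-nonNeg 0≤b))
    0≤B : 0ℚ ≤ ⅓ * B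
    0≤B = *-nonNeg 0≤⅓ (+-nonNeg (+-nonNeg (cube-nonNeg 0≤c) (cube-nonNeg 0≤c)) (cube-nonNeg 0≤d))
    :cube : ∀ {n} → +-*-Solver.Polynomial n → +-*-Solver.Polynomial n
    :cube q = q :* q :* q

-- Conditioning on the first sample leaves three pairs of slices, as the two bits are never both 1.
-- With `a`, `b`, `c`, `d` above the cube roots of the slice means, induction bounds the three
-- correlations by `a² c²`, `a² d²` and `b² c²`, which are the terms of the two-point inequality.
hypercontractivity : ∀ {ℓ} {f g : Vec (Fin 2) ℓ → ℚ} →
  (∀ u → 0ℚ ≤ f u × f u ≤ 1ℚ) → (∀ v → 0ℚ ≤ g v × g v ≤ 1ℚ) →
  ∀ {y z} → 0ℚ ≤ y → 0ℚ ≤ z → mean f < cube y → mean g < cube z →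
  correlation f g ≤ y * y * (z * z)
hypercontractivity {zero} f∈ g∈ {y} 0≤y 0≤z f< g< =
  *-mono (square-nonNeg y) (proj₁ (g∈ []))
    (≤1⇒≤square 0≤y (proj₂ (f∈ [])) f<) (≤1⇒≤square 0≤z (proj₂ (g∈ [])) g<)
hypercontractivity {suc ℓ} {f} {g} f∈ g∈ {y} {z} 0≤y 0≤z f< g< =
  let f₀∈ = f∈ ∘ (zero ∷_)
      f₁∈ = f∈ ∘ (suc zero ∷_)
      g₀∈ = g∈ ∘ (zero ∷_)
      g₁∈ = g∈ ∘ (suc zero ∷_)
      a , b , 0≤a , 0≤b , f₀< , f₁< , ab≤ =
        split-mean {y = y} (mean-nonNeg (proj₁ ∘ f₀∈)) (mean-nonNeg (proj₁ ∘ f₁∈)) f<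
      c , d , 0≤c , 0≤d , g₀< , g₁< , cd≤ =
        split-mean {y = z} (mean-nonNeg (proj₁ ∘ g₀∈)) (mean-nonNeg (proj₁ ∘ g₁∈)) g<
  in ≤-trans
    (⅓-mono (+-mono-≤ (+-mono-≤
      (hypercontractivity f₀∈ g₀∈ 0≤a 0≤c f₀< g₀<)
      (hypercontractivity f₀∈ g₁∈ 0≤a 0≤d f₀< g₁<))
      (hypercontractivity f₁∈ g₀∈ 0≤b 0≤c f₁< g₀<)))
    (≤-trans (≤-reflexive (cong (λ s → ⅓ * (s + b * b * (c * c))) (sym (*-distribˡ-+ (a * a) (c * c) (d * d)))))
      (two-point-mean 0≤y 0≤z 0≤a 0≤b 0≤c 0≤d ab≤ cd≤))

-- Finite sums

∑ℚ : List X → (X → ℚ) → ℚ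
∑ℚ xs f = foldr _+_ 0ℚ (map f xs)

∑ℚ-cong : ∀ (xs : List X) {f g} → (∀ x → f x ≡ g x) → ∑ℚ xs f ≡ ∑ℚ xs g
∑ℚ-cong []       f≗g = refl
∑ℚ-cong (x ∷ xs) f≗g = cong₂ _+_ (f≗g x) (∑ℚ-cong xs f≗g)

∑ℚ-mono : ∀ (xs : List X) {f g} → (∀ x → f x ≤ g x) → ∑ℚ xs f ≤ ∑ℚ xs g
∑ℚ-mono []       f≤g = ≤-refl
∑ℚ-mono (x ∷ xs) f≤g = +-mono-≤ (f≤g x) (∑ℚ-mono xs f≤g)

∑ℚ-nonNeg : ∀ (xs : List X) {f} → (∀ x → 0ℚ ≤ f x) → 0ℚ ≤ ∑ℚ xs f
∑ℚ-nonNeg []       0≤f = ≤-refl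
∑ℚ-nonNeg (x ∷ xs) 0≤f = +-nonNeg (0≤f x) (∑ℚ-nonNeg xs 0≤f)

∑ℚ-+ : ∀ (xs : List X) (f g : X → ℚ) → ∑ℚ xs (λ x → f x + g x) ≡ ∑ℚ xs f + ∑ℚ xs g
∑ℚ-+ []       f g = refl
∑ℚ-+ (x ∷ xs) f g = trans (cong (_+_ (f x + g x)) (∑ℚ-+ xs f g))
  (solve 4 (λ a b c d → a :+ b :+ (c :+ d) := a :+ c :+ (b :+ d)) refl (f x) (g x) (∑ℚ xs f) (∑ℚ xs g))

∑ℚ-*ˡ : ∀ (xs : List X) c (f : X → ℚ) → ∑ℚ xs (λ x → c * f x) ≡ c * ∑ℚ xs f
∑ℚ-*ˡ []       c f = sym (*-zeroʳ c)
∑ℚ-*ˡ (x ∷ xs) c f = trans (cong (_+_ (c * f x)) (∑ℚ-*ˡ xs c f)) (sym (*-distribˡ-+ c (f x) (∑ℚ xs f)))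

∑ℚ-*ʳ : ∀ (xs : List X) c (f : X → ℚ) → ∑ℚ xs (λ x → f x * c) ≡ ∑ℚ xs f * c
∑ℚ-*ʳ xs c f = trans (∑ℚ-cong xs (λ x → *-comm (f x) c)) (trans (∑ℚ-*ˡ xs c f) (*-comm c (∑ℚ xs f)))

∑ℚ-const : ∀ (xs : List X) c → ∑ℚ xs (λ _ → c) ≡ ι (length xs) * c
∑ℚ-const []       c = sym (*-zeroˡ c)
∑ℚ-const (x ∷ xs) c = trans (cong (_+_ c) (∑ℚ-const xs c))
  (trans (solve 2 (λ c n → c :+ n :* c := (con 1ℚ :+ n) :* c) refl c (ι (length xs)))
    (cong (_* c) (sym (ι-suc (length xs)))))

∑ℚ-zero : ∀ (xs : List X) → ∑ℚ xs (λ _ → 0ℚ) ≡ 0ℚ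
∑ℚ-zero xs = trans (∑ℚ-const xs 0ℚ) (*-zeroʳ (ι (length xs)))

∑ℚ-swap : ∀ (xs : List X) (ys : List Y) (f : X → Y → ℚ) →
  ∑ℚ xs (λ x → ∑ℚ ys (f x)) ≡ ∑ℚ ys (λ y → ∑ℚ xs (λ x → f x y))
∑ℚ-swap []       ys f = sym (∑ℚ-zero ys)
∑ℚ-swap (x ∷ xs) ys f = trans (cong (_+_ (∑ℚ ys (f x))) (∑ℚ-swap xs ys f))
  (sym (∑ℚ-+ ys (f x) (λ y → ∑ℚ xs (λ x → f x y))))

∑ℚ-product : ∀ (xs : List X) (ys : List Y) (f : X → ℚ) (g : Y → ℚ) →
  ∑ℚ xs (λ x → ∑ℚ ys (λ y → f x * g y)) ≡ ∑ℚ xs f * ∑ℚ ys g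
∑ℚ-product xs ys f g = trans (∑ℚ-cong xs (λ x → ∑ℚ-*ˡ ys (f x) g)) (∑ℚ-*ʳ xs (∑ℚ ys g) f)

∑ℚ-++ : ∀ (xs ys : List X) (f : X → ℚ) → ∑ℚ (xs ++ ys) f ≡ ∑ℚ xs f + ∑ℚ ys f
∑ℚ-++ []       ys f = sym (+-identityˡ (∑ℚ ys f))
∑ℚ-++ (x ∷ xs) ys f = trans (cong (_+_ (f x)) (∑ℚ-++ xs ys f)) (sym (+-assoc (f x) (∑ℚ xs f) (∑ℚ ys f)))

∑ℚ-map : ∀ (h : X → Y) xs (f : Y → ℚ) → ∑ℚ (map h xs) f ≡ ∑ℚ xs (f ∘ h)
∑ℚ-map h []       f = refl
∑ℚ-map h (x ∷ xs) f = cong (_+_ (f (h x))) (∑ℚ-map h xs f)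

∑ℚ-vectors : ∀ (xs : List X) n (f : Vec X (suc n) → ℚ) →
  ∑ℚ (vectors xs (suc n)) f ≡ ∑ℚ xs (λ x → ∑ℚ (vectors xs n) (λ v → f (x ∷ v)))
∑ℚ-vectors xs n f = go xs
  where
  go : ∀ ys → ∑ℚ (cartesianProductWith _∷_ ys (vectors xs n)) f
    ≡ ∑ℚ ys (λ x → ∑ℚ (vectors xs n) (λ v → f (x ∷ v)))
  go []       = refl
  go (y ∷ ys) = trans (∑ℚ-++ (map (y ∷_) (vectors xs n)) _ f)
    (cong₂ _+_ (∑ℚ-map (y ∷_) (vectors xs n) f) (go ys))

∑ℚ-allFin : ∀ {n} (f : Fin (suc n) → ℚ) → ∑ℚ (allFin (suc n)) f ≡ f zero + ∑ℚ (allFin n) (f ∘ suc)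
∑ℚ-allFin {n} f = cong (_+_ (f zero))
  (trans (cong (λ xs → ∑ℚ xs f) (sym (map-tabulate {n = n} (λ i → i) suc))) (∑ℚ-map suc (allFin n) f))

∑ℚ-pigeonhole : ∀ {n} .{{_ : NonZero n}} (f : Fin n → ℚ) t → ∑ℚ (allFin n) f ≤ ι n * t → ∃[ i ] f i ≤ t
∑ℚ-pigeonhole {suc n} f t ∑≤ with f zero ≤? t
... | yes f₀≤t = zero , f₀≤t
∑ℚ-pigeonhole {suc zero} f t ∑≤ | no f₀≰t =
  contradiction (subst₂ _≤_ (+-identityʳ (f zero)) (*-identityˡ t) ∑≤) f₀≰t
∑ℚ-pigeonhole {suc (suc n)} f t ∑≤ | no f₀≰t =
  let i , fᵢ≤t = ∑ℚ-pigeonhole (f ∘ suc) t tail≤ in suc i , fᵢ≤t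
  where
  R = ∑ℚ (allFin (suc n)) (f ∘ suc)
  ∑≤′ : f zero + R ≤ t + ι (suc n) * t
  ∑≤′ = subst₂ _≤_ (∑ℚ-allFin f)
    (trans (cong (_* t) (ι-suc (suc n)))
      (solve 2 (λ n t → (con 1ℚ :+ n) :* t := t :+ n :* t) refl (ι (suc n)) t)) ∑≤
  tail≤ : R ≤ ι (suc n) * t
  tail≤ with R ≤? ι (suc n) * t
  ... | yes R≤ = R≤
  ... | no  R≰ = contradiction (<-≤-trans (+-mono-< (≰⇒> f₀≰t) (≰⇒> R≰)) ∑≤′) (<-irrefl refl)

-- Linearity of means and correlations

mean-const : ∀ ℓ c → mean {ℓ} (λ _ → c) ≡ c
mean-const zero    c = refl
mean-const (suc ℓ) c = trans (cong (λ a → ⅓ * (a + a + a)) (mean-const ℓ c))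
  (solve 1 (λ a → con ⅓ :* (a :+ a :+ a) := a) refl c)

mean-mono : ∀ {ℓ} {f g : Vec (Fin 2) ℓ → ℚ} → (∀ u → f u ≤ g u) → mean f ≤ mean g
mean-mono {zero}  f≤g = f≤g []
mean-mono {suc ℓ} f≤g = ⅓-mono (+-mono-≤ (+-mono-≤ f₀≤g₀ f₀≤g₀) (mean-mono (f≤g ∘ (suc zero ∷_))))
  where f₀≤g₀ = mean-mono (f≤g ∘ (zero ∷_))

mean-+ : ∀ {ℓ} (f g : Vec (Fin 2) ℓ → ℚ) → mean (λ u → f u + g u) ≡ mean f + mean g
mean-+ {zero}  f g = refl
mean-+ {suc ℓ} f g = trans (cong₂ (λ a b → ⅓ * (a + a + b)) (mean-+ f₀ g₀) (mean-+ f₁ g₁))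
  (solve 4 (λ a b c d → con ⅓ :* (a :+ b :+ (a :+ b) :+ (c :+ d))
    := con ⅓ :* (a :+ a :+ c) :+ con ⅓ :* (b :+ b :+ d)) refl (mean f₀) (mean g₀) (mean f₁) (mean g₁))
  where
  f₀ = f ∘ (zero ∷_)
  f₁ = f ∘ (suc zero ∷_)
  g₀ = g ∘ (zero ∷_)
  g₁ = g ∘ (suc zero ∷_)

mean-*ˡ : ∀ {ℓ} c (f : Vec (Fin 2) ℓ → ℚ) → mean (λ u → c * f u) ≡ c * mean f
mean-*ˡ {zero}  c f = refl
mean-*ˡ {suc ℓ} c f = trans (cong₂ (λ a b → ⅓ * (a + a + b)) (mean-*ˡ c f₀) (mean-*ˡ c f₁))
  (solve 3 (λ c a b → con ⅓ :* (c :* a :+ c :* a :+ c :* b) := c :* (con ⅓ :* (a :+ a :+ b)))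
    refl c (mean f₀) (mean f₁))
  where
  f₀ = f ∘ (zero ∷_)
  f₁ = f ∘ (suc zero ∷_)

mean-∑ℚ : ∀ {ℓ} (xs : List X) (f : X → Vec (Fin 2) ℓ → ℚ) →
  mean (λ u → ∑ℚ xs (λ x → f x u)) ≡ ∑ℚ xs (λ x → mean (f x))
mean-∑ℚ {ℓ = ℓ} []       f = mean-const ℓ 0ℚ
mean-∑ℚ         (x ∷ xs) f = trans (mean-+ (f x) (λ u → ∑ℚ xs (λ x → f x u)))
  (cong (_+_ (mean (f x))) (mean-∑ℚ xs f))

correlation-cong : ∀ {ℓ} {f f′ g g′ : Vec (Fin 2) ℓ → ℚ} →
  (∀ u → f u ≡ f′ u) → (∀ v → g v ≡ g′ v) → correlation f g ≡ correlation f′ g′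
correlation-cong {zero}  f≗ g≗ = cong₂ _*_ (f≗ []) (g≗ [])
correlation-cong {suc ℓ} f≗ g≗ = cong (⅓ *_) (cong₂ _+_ (cong₂ _+_
  (correlation-cong (f≗ ∘ (zero ∷_)) (g≗ ∘ (zero ∷_)))
  (correlation-cong (f≗ ∘ (zero ∷_)) (g≗ ∘ (suc zero ∷_))))
  (correlation-cong (f≗ ∘ (suc zero ∷_)) (g≗ ∘ (zero ∷_))))

correlation-* : ∀ {ℓ} c d (f g : Vec (Fin 2) ℓ → ℚ) →
  correlation (λ u → c * f u) (λ v → d * g v) ≡ c * d * correlation f g
correlation-* {zero} c d f g =
  solve 4 (λ c d a b → c :* a :* (d :* b) := c :* d :* (a :* b)) refl c d (f []) (g [])
correlation-* {suc ℓ} c d f g = trans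
  (cong (⅓ *_) (cong₂ _+_ (cong₂ _+_ (correlation-* c d f₀ g₀) (correlation-* c d f₀ g₁))
    (correlation-* c d f₁ g₀)))
  (solve 4 (λ k x y z → con ⅓ :* (k :* x :+ k :* y :+ k :* z) := k :* (con ⅓ :* (x :+ y :+ z)))
    refl (c * d) (correlation f₀ g₀) (correlation f₀ g₁) (correlation f₁ g₀))
  where
  f₀ = f ∘ (zero ∷_)
  f₁ = f ∘ (suc zero ∷_)
  g₀ = g ∘ (zero ∷_)
  g₁ = g ∘ (suc zero ∷_)

-- Membership indicators

indicator : Bool → ℚ
indicator b = if b then 1ℚ else 0ℚ

𝟙[_∈_] : ∀ {n} → Fin n → Subset n → ℚ
𝟙[ i ∈ S ] = indicator (does (i ∈? S))

indicator-nonNeg : ∀ b → 0ℚ ≤ indicator b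
indicator-nonNeg true  = 0≤1
indicator-nonNeg false = ≤-refl

indicator-≤1 : ∀ b → indicator b ≤ 1ℚ
indicator-≤1 true  = ≤-refl
indicator-≤1 false = 0≤1

𝟙-suc : ∀ {n} b (i : Fin n) S → 𝟙[ suc i ∈ b ∷ S ] ≡ 𝟙[ i ∈ S ]
𝟙-suc true  i S = refl
𝟙-suc false i S = refl

∑ℚ-𝟙 : ∀ {n} (S : Subset n) → ∑ℚ (allFin n) 𝟙[_∈ S ] ≡ ι ∣ S ∣
∑ℚ-𝟙 []      = refl
∑ℚ-𝟙 (b ∷ S) = trans (∑ℚ-allFin 𝟙[_∈ b ∷ S ])
  (trans (cong (_+_ 𝟙[ zero ∈ b ∷ S ]) (trans (∑ℚ-cong (allFin _) (λ i → 𝟙-suc b i S)) (∑ℚ-𝟙 S))) (head b))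
  where
  head : ∀ b → 𝟙[ zero ∈ b ∷ S ] + ι ∣ S ∣ ≡ ι ∣ b ∷ S ∣
  head true  = sym (ι-suc ∣ S ∣)
  head false = +-identityˡ (ι ∣ S ∣)

𝟙-∩ : ∀ {n} (i : Fin n) S T → 𝟙[ i ∈ S ∩ T ] ≡ 𝟙[ i ∈ S ] * 𝟙[ i ∈ T ]
𝟙-∩ zero    (true  ∷ S) (true  ∷ T) = refl
𝟙-∩ zero    (true  ∷ S) (false ∷ T) = refl
𝟙-∩ zero    (false ∷ S) (true  ∷ T) = refl
𝟙-∩ zero    (false ∷ S) (false ∷ T) = refl
𝟙-∩ (suc i) (b ∷ S)     (c ∷ T)     = trans (𝟙-suc (b ∧ c) i (S ∩ T))
  (trans (𝟙-∩ i S T) (sym (cong₂ _*_ (𝟙-suc b i S) (𝟙-suc c i T))))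

-- Here a u approximates the law of A(u), so that hit a i u stands for Pr[i ∈ A(u)].
SubsetWeights : ℕ → ℕ → Set
SubsetWeights ℓ n = Vec (Fin 2) ℓ → Subset n → ℚ

hit : ∀ {ℓ n} → SubsetWeights ℓ n → Fin n → Vec (Fin 2) ℓ → ℚ
hit {n = n} a i u = ∑ℚ (subsets n) (λ S → a u S * 𝟙[ i ∈ S ])

-- The total may reach 2: approximate masses, once shifted to be nonnegative, can overshoot 1.
-- Halving brings the hit probabilities back into [0,1]. `σ` bounds the expected size of the set.
record Bounded {ℓ n} (σ : ℚ) (a : SubsetWeights ℓ n) : Set where
  field
    nonNegative-weight : ∀ u S → 0ℚ ≤ a u S
    total-weight       : ∀ u → ∑ℚ (subsets n) (a u) ≤ ι 2
    total-size         : ∀ u → ∑ℚ (subsets n) (λ S → a u S * ι ∣ S ∣) ≤ σ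

  hit-nonNeg : ∀ i u → 0ℚ ≤ hit a i u
  hit-nonNeg i u = ∑ℚ-nonNeg (subsets n) (λ S →
    *-nonNeg (nonNegative-weight u S) (indicator-nonNeg (does (i ∈? S))))

  hit-≤2 : ∀ i u → hit a i u ≤ ι 2
  hit-≤2 i u = ≤-trans (∑ℚ-mono (subsets n) (λ S → subst (a u S * 𝟙[ i ∈ S ] ≤_) (*-identityʳ (a u S))
    (*-monoˡ-≤-nonNeg (a u S) {{nonNegative (nonNegative-weight u S)}} (indicator-≤1 (does (i ∈? S))))))
    (total-weight u)

  ½hit : ∀ i u → 0ℚ ≤ ½ * hit a i u × ½ * hit a i u ≤ 1ℚ
  ½hit i u = *-nonNeg (toWitness {a? = 0ℚ ≤? ½} _) (hit-nonNeg i u)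
           , *-monoˡ-≤-nonNeg ½ (hit-≤2 i u)

  -- Linearity of expectation: summing Pr[i ∈ A(u)] over `i` gives the expected size of A(u).
  ∑-mean-hit : ∑ℚ (allFin n) (λ i → mean (hit a i)) ≤ σ
  ∑-mean-hit = begin
    ∑ℚ (allFin n) (λ i → mean (hit a i))               ≡⟨ mean-∑ℚ (allFin n) (hit a) ⟨
    mean (λ u → ∑ℚ (allFin n) (λ i → hit a i u))
      ≤⟨ mean-mono (λ u → ≤-trans (≤-reflexive (size u)) (total-size u)) ⟩
    mean {ℓ} (λ _ → σ)                                 ≡⟨ mean-const ℓ σ ⟩
    σ                                                  ∎
    where
    open ≤-Reasoning
    size : ∀ u → ∑ℚ (allFin n) (λ i → hit a i u) ≡ ∑ℚ (subsets n) (λ S → a u S * ι ∣ S ∣)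
    size u = trans (∑ℚ-swap (allFin n) (subsets n) (λ i S → a u S * 𝟙[ i ∈ S ]))
      (∑ℚ-cong (subsets n) (λ S → trans (∑ℚ-*ˡ (allFin n) (a u S) 𝟙[_∈ S ]) (cong (a u S *_) (∑ℚ-𝟙 S))))

-- The lower bound for rational weights

⅛ : ℚ
⅛ = + 1 / 8

-- Equivalently (⅛ / n)³ ≤ (2 σ / n)⁴, where v = 1 / n.
lower-bound-arithmetic : ∀ {v N σ y} → v * N ≡ 1ℚ → 0ℚ ≤ v → 0ℚ ≤ N → 0ℚ ≤ σ → 0ℚ ≤ y →
  ⅛ * v ≤ y * y * (y * y) → cube y ≤ σ * v + σ * v → N ≤ ι 8192 * (σ * σ * (σ * σ))
lower-bound-arithmetic {v} {N} {σ} {y} vN 0≤v 0≤N 0≤σ 0≤y ⅛v≤y⁴ y³≤t = begin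
  N                            ≡⟨ trans (cong (λ s → N * cube s) vN) (*-identityʳ N) ⟨
  N * cube (v * N)
    ≡⟨ solve 2 (λ v n → n :* :cube (v :* n) := con (ι 512) :* (n :* n :* (n :* n)) :* :cube (con ⅛ :* v)) refl v N ⟩
  M * cube (⅛ * v)             ≤⟨ *-monoˡ-≤-nonNeg M {{nonNegative 0≤M}} (cube-mono-≤ 0≤⅛v ⅛v≤y⁴) ⟩
  M * cube (y * y * (y * y))
    ≡⟨ cong (M *_) (solve 1 (λ y → :cube (y :* y :* (y :* y)) := :cube y :* :cube y :* (:cube y :* :cube y)) refl y) ⟩
  M * (cube y * cube y * (cube y * cube y))
    ≤⟨ *-monoˡ-≤-nonNeg M {{nonNegative 0≤M}} (*-mono (*-nonNeg 0≤t 0≤t) (square-nonNeg (cube y)) y⁶≤t² y⁶≤t²) ⟩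
  M * (t * t * (t * t))        ≡⟨ solve 3 (λ v n s → let t = s :* v :+ s :* v ; w = v :* n in
                                    con (ι 512) :* (n :* n :* (n :* n)) :* (t :* t :* (t :* t))
                                    := con (ι 8192) :* (s :* s :* (s :* s)) :* (w :* w :* (w :* w))) refl v N σ ⟩
  ι 8192 * (σ * σ * (σ * σ)) * (v * N * (v * N) * (v * N * (v * N)))
    ≡⟨ cong (λ s → ι 8192 * (σ * σ * (σ * σ)) * (s * s * (s * s))) vN ⟩
  ι 8192 * (σ * σ * (σ * σ)) * 1ℚ  ≡⟨ *-identityʳ _ ⟩
  ι 8192 * (σ * σ * (σ * σ))   ∎
  where
  open ≤-Reasoning
  :cube : ∀ {n} → +-*-Solver.Polynomial n → +-*-Solver.Polynomial n
  :cube q = q :* q :* q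

  M t : ℚ
  M = ι 512 * (N * N * (N * N))
  t = σ * v + σ * v

  0≤M : 0ℚ ≤ M
  0≤M = *-nonNeg (ι-nonNeg 512) (square-nonNeg (N * N))

  0≤t : 0ℚ ≤ t
  0≤t = +-nonNeg (*-nonNeg 0≤σ 0≤v) (*-nonNeg 0≤σ 0≤v)

  y⁶≤t² : cube y * cube y ≤ t * t
  y⁶≤t² = *-mono 0≤t (cube-nonNeg 0≤y) y³≤t y³≤t

  0≤⅛v : 0ℚ ≤ ⅛ * v
  0≤⅛v = *-nonNeg (toWitness {a? = 0ℚ ≤? ⅛} _) 0≤v

module _ {ℓ n : ℕ} .{{_ : NonZero n}} {a b : SubsetWeights ℓ n} {σ v : ℚ} (0<σ : 0ℚ < σ)
  (0<v : 0ℚ < v) (vN : v * ι n ≡ 1ℚ) (a-bounded : Bounded σ a) (b-bounded : Bounded σ b)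
  (collision : ∀ i → ½ * v ≤ correlation (hit a i) (hit b i)) where

  private
    module A = Bounded a-bounded
    module B = Bounded b-bounded

    r t : ℚ
    r = σ * v
    t = r + r

    0<r : 0ℚ < r
    0<r = *-pos 0<σ 0<v

    -- Averaging the sum of the two means, not each mean separately, yields one `i` that is rare for
    -- both players at once.
    rare : ∃[ i ] mean (hit a i) + mean (hit b i) ≤ t
    rare = ∑ℚ-pigeonhole (λ i → mean (hit a i) + mean (hit b i)) t (begin
      ∑ℚ (allFin n) (λ i → mean (hit a i) + mean (hit b i))
        ≡⟨ ∑ℚ-+ (allFin n) (λ i → mean (hit a i)) (λ i → mean (hit b i)) ⟩
      ∑ℚ (allFin n) (λ i → mean (hit a i)) + ∑ℚ (allFin n) (λ i → mean (hit b i))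
        ≤⟨ +-mono-≤ A.∑-mean-hit B.∑-mean-hit ⟩
      σ + σ
        ≡⟨ trans (cong (_* (σ + σ)) vN) (*-identityˡ (σ + σ)) ⟨
      v * ι n * (σ + σ)
        ≡⟨ solve 3 (λ v n s → v :* n :* (s :+ s) := n :* (s :* v :+ s :* v)) refl v (ι n) σ ⟩
      ι n * t ∎)
      where open ≤-Reasoning

    module _ {i y} (means≤t : mean (hit a i) + mean (hit b i) ≤ t) (0≤y : 0ℚ ≤ y) (r<y³ : r < cube y) where

      half-mean : ∀ (f : Vec (Fin 2) ℓ → ℚ) → mean f ≤ t → mean (λ u → ½ * f u) < cube y
      half-mean f mean≤t = ≤-<-trans (≤-trans (≤-reflexive (mean-*ˡ ½ f))
        (≤-trans (*-monoˡ-≤-nonNeg ½ mean≤t) (≤-reflexive (solve 1 (λ r → con ½ :* (r :+ r) := r) refl r)))) r<y³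

      mean-hit-a≤t : mean (hit a i) ≤ t
      mean-hit-a≤t = ≤-trans (≤-by-difference (mean (hit b i)) (mean-nonNeg (B.hit-nonNeg i)) refl) means≤t

      mean-hit-b≤t : mean (hit b i) ≤ t
      mean-hit-b≤t = ≤-trans (≤-by-difference (mean (hit a i)) (mean-nonNeg (A.hit-nonNeg i))
        (+-comm (mean (hit b i)) (mean (hit a i)))) means≤t

      -- Of the factor 1/8, one half is lost in approximating the collision probability and one in
      -- scaling each player's hit probability into [0,1].
      ⅛v≤y⁴ : ⅛ * v ≤ y * y * (y * y)
      ⅛v≤y⁴ = begin
        ⅛ * v                                    ≡⟨ *-assoc (½ * ½) ½ v ⟩
        ½ * ½ * (½ * v)                          ≤⟨ *-monoˡ-≤-nonNeg (½ * ½) (collision i) ⟩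
        ½ * ½ * correlation (hit a i) (hit b i)  ≡⟨ correlation-* ½ ½ (hit a i) (hit b i) ⟨
        correlation (λ u → ½ * hit a i u) (λ u → ½ * hit b i u)
          ≤⟨ hypercontractivity (A.½hit i) (B.½hit i) 0≤y 0≤y
               (half-mean (hit a i) mean-hit-a≤t) (half-mean (hit b i) mean-hit-b≤t) ⟩
        y * y * (y * y) ∎
        where open ≤-Reasoning

  weights-lower-bound : ι n ≤ ι 8192 * (σ * σ * (σ * σ))
  weights-lower-bound =
    let i , means≤t = rare
        -- Taking `r` itself as the tolerance gives `r < cube y ≤ r + r`; the factor 2 only affects
        -- the constant.
        y , 0≤y , r<y³ , y³≤t = cubes-dense (<⇒≤ 0<r) 0<r
    in lower-bound-arithmetic vN (<⇒≤ 0<v) (ι-nonNeg n) (<⇒≤ 0<σ) 0≤y (⅛v≤y⁴ {i} means≤t 0≤y r<y³) y³≤t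

-- Real numbers at a fixed index of their sequences

seq-∑ : ∀ (xs : List X) (f : X → ℝ) m → seq (∑ xs f) m ≡ ∑ℚ xs (λ x → seq (f x) m)
seq-∑ []       f m = refl
seq-∑ (x ∷ xs) f m = cong (_+_ (seq (f x) m)) (seq-∑ xs f m)

indicatorℝ : Bool → ℝ
indicatorℝ b = if b then 1ℝ else 0ℝ

seq-indicatorℝ : ∀ b m → seq (indicatorℝ b) m ≡ indicator b
seq-indicatorℝ true  m = refl
seq-indicatorℝ false m = refl

tensor-nonNeg : ∀ {ℓ} (u v : Vec (Fin 2) ℓ) m → 0ℚ ≤ seq (tensor ρ-disj u v) m
tensor-nonNeg []      []      m = 0≤1
tensor-nonNeg (x ∷ u) (y ∷ v) m = *-nonNeg (weight x y) (tensor-nonNeg u v m)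
  where
  weight : ∀ x y → 0ℚ ≤ seq (mass ρ-disj (x , y)) m
  weight zero       zero       = 0≤⅓
  weight zero       (suc zero) = 0≤⅓
  weight (suc zero) zero       = 0≤⅓
  weight (suc zero) (suc zero) = ≤-refl

-- Ties the recursive `correlation` to the double sum over sample words. It is exact at every index
-- because the masses of `ρ-disj` are constant sequences.
correlation-∑ : ∀ {ℓ} (f g : Vec (Fin 2) ℓ → ℚ) m →
  ∑ℚ (vectors (allFin 2) ℓ) (λ u → ∑ℚ (vectors (allFin 2) ℓ) (λ v →
    seq (tensor ρ-disj u v) m * (f u * g v))) ≡ correlation f g
correlation-∑ {zero} f g m =
  solve 1 (λ p → con 1ℚ :* p :+ con 0ℚ :+ con 0ℚ := p) refl (f [] * g [])
correlation-∑ {suc ℓ} f g m = begin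
  ∑ℚ (vectors two (suc ℓ)) (λ u → ∑ℚ (vectors two (suc ℓ)) (F u))
    ≡⟨ ∑ℚ-vectors two ℓ (λ u → ∑ℚ (vectors two (suc ℓ)) (F u)) ⟩
  ∑ℚ two (λ x → ∑ℚ us (λ u → ∑ℚ (vectors two (suc ℓ)) (F (x ∷ u))))
    ≡⟨ ∑ℚ-cong two (λ x → ∑ℚ-cong us (λ u → ∑ℚ-vectors two ℓ (F (x ∷ u)))) ⟩
  ∑ℚ two (λ x → ∑ℚ us (λ u → ∑ℚ two (λ y → ∑ℚ us (λ v → F (x ∷ u) (y ∷ v)))))
    ≡⟨ ∑ℚ-cong two (λ x → ∑ℚ-swap us two (λ u y → ∑ℚ us (λ v → F (x ∷ u) (y ∷ v)))) ⟩
  ∑ℚ two (λ x → ∑ℚ two (λ y → ∑ℚ us (λ u → ∑ℚ us (λ v → F (x ∷ u) (y ∷ v)))))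
    ≡⟨ ∑ℚ-cong two (λ x → ∑ℚ-cong two (λ y → block x y)) ⟩
  ∑ℚ two (λ x → ∑ℚ two (λ y → μ x y * correlation (f ∘ (x ∷_)) (g ∘ (y ∷_))))
    ≡⟨ solve 4 (λ a b c d → con ⅓ :* a :+ (con ⅓ :* b :+ con 0ℚ) :+ (con ⅓ :* c :+ (con 0ℚ :* d :+ con 0ℚ) :+ con 0ℚ)
         := con ⅓ :* (a :+ b :+ c)) refl
         (correlation (f ∘ (zero ∷_)) (g ∘ (zero ∷_))) (correlation (f ∘ (zero ∷_)) (g ∘ (suc zero ∷_)))
         (correlation (f ∘ (suc zero ∷_)) (g ∘ (zero ∷_))) (correlation (f ∘ (suc zero ∷_)) (g ∘ (suc zero ∷_))) ⟩
  correlation f g ∎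
  where
  open ≡-Reasoning
  two = allFin 2
  us = vectors two ℓ
  μ : Fin 2 → Fin 2 → ℚ
  μ x y = seq (mass ρ-disj (x , y)) m
  F : Vec (Fin 2) (suc ℓ) → Vec (Fin 2) (suc ℓ) → ℚ
  F u v = seq (tensor ρ-disj u v) m * (f u * g v)
  block : ∀ x y → ∑ℚ us (λ u → ∑ℚ us (λ v → F (x ∷ u) (y ∷ v)))
    ≡ μ x y * correlation (f ∘ (x ∷_)) (g ∘ (y ∷_))
  block x y = trans
    (∑ℚ-cong us (λ u → trans
      (∑ℚ-cong us (λ v → *-assoc (μ x y) (seq (tensor ρ-disj u v) m) (f (x ∷ u) * g (y ∷ v))))
      (∑ℚ-*ˡ us (μ x y) (λ v → seq (tensor ρ-disj u v) m * (f (x ∷ u) * g (y ∷ v))))))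
    (trans (∑ℚ-*ˡ us (μ x y) (λ u → ∑ℚ us (λ v → seq (tensor ρ-disj u v) m * (f (x ∷ u) * g (y ∷ v)))))
      (cong (μ x y *_) (correlation-∑ (f ∘ (x ∷_)) (g ∘ (y ∷_)) m)))

weights : ∀ {ℓ n} → RandomisedMap (Vec (Fin 2) ℓ) n → ℕ → SubsetWeights ℓ n
weights A m u S = seq (mass (A u) S) m

collisionWeight : ∀ {ℓ n} → SubsetWeights ℓ n → SubsetWeights ℓ n → Fin n → ℕ → ℚ
collisionWeight {ℓ} {n} a b i m =
  ∑ℚ (vectors (allFin 2) ℓ) λ u → ∑ℚ (vectors (allFin 2) ℓ) λ v →
  ∑ℚ (subsets n) λ S → ∑ℚ (subsets n) λ T →
    seq (tensor ρ-disj u v) m * (a u S * b v T) * 𝟙[ i ∈ S ∩ T ]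

seq-collisionProbability : ∀ {ℓ n} A B (i : Fin n) m →
  seq (collisionProbability ρ-disj ℓ A B i) m ≡ collisionWeight (weights A m) (weights B m) i m
seq-collisionProbability {ℓ} {n} A B i m =
  trans (seq-∑ us _ m) (∑ℚ-cong us λ u →
  trans (seq-∑ us _ m) (∑ℚ-cong us λ v →
  trans (seq-∑ Ss _ m) (∑ℚ-cong Ss λ S →
  trans (seq-∑ Ss _ m) (∑ℚ-cong Ss λ T →
  cong (seq (tensor ρ-disj u v) m * (weights A m u S * weights B m v T) *_)
    (seq-indicatorℝ (does (i ∈? (S ∩ T))) m)))))
  where
  us = vectors (allFin 2) ℓ
  Ss = subsets n

-- Since the players randomise independently, for fixed `u` and `v` the sum over `S` and `T`
-- factorises into the two hit probabilities.
collisionWeight-correlation : ∀ {ℓ n} (a b : SubsetWeights ℓ n) i m →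
  collisionWeight a b i m ≡ correlation (hit a i) (hit b i)
collisionWeight-correlation {ℓ} {n} a b i m =
  trans (∑ℚ-cong us λ u → ∑ℚ-cong us λ v → begin
    ∑ℚ Ss (λ S → ∑ℚ Ss (λ T → w u v * (a u S * b v T) * 𝟙[ i ∈ S ∩ T ]))
      ≡⟨ ∑ℚ-cong Ss (λ S → ∑ℚ-cong Ss (λ T → trans
           (cong (w u v * (a u S * b v T) *_) (𝟙-∩ i S T))
           (solve 5 (λ w a b p q → w :* (a :* b) :* (p :* q) := w :* (a :* p :* (b :* q)))
             refl (w u v) (a u S) (b v T) 𝟙[ i ∈ S ] 𝟙[ i ∈ T ]))) ⟩
    ∑ℚ Ss (λ S → ∑ℚ Ss (λ T → w u v * (α u S * β v T)))
      ≡⟨ ∑ℚ-cong Ss (λ S → ∑ℚ-*ˡ Ss (w u v) (λ T → α u S * β v T)) ⟩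
    ∑ℚ Ss (λ S → w u v * ∑ℚ Ss (λ T → α u S * β v T))
      ≡⟨ ∑ℚ-*ˡ Ss (w u v) (λ S → ∑ℚ Ss (λ T → α u S * β v T)) ⟩
    w u v * ∑ℚ Ss (λ S → ∑ℚ Ss (λ T → α u S * β v T))
      ≡⟨ cong (w u v *_) (∑ℚ-product Ss Ss (α u) (β v)) ⟩
    w u v * (hit a i u * hit b i v) ∎)
  (correlation-∑ (hit a i) (hit b i) m)
  where
  open ≡-Reasoning
  us = vectors (allFin 2) ℓ
  Ss = subsets n
  w : Vec (Fin 2) ℓ → Vec (Fin 2) ℓ → ℚ
  w u v = seq (tensor ρ-disj u v) m
  α β : Vec (Fin 2) ℓ → Subset n → ℚ
  α u S = a u S * 𝟙[ i ∈ S ]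
  β v T = b v T * 𝟙[ i ∈ T ]

-- A product of two slightly negative numbers can be positive; shifting by 2 ε
-- instead of ε makes up for it.
collisionWeight-shift : ∀ {ℓ n ε} {a b : SubsetWeights ℓ n} → 0ℚ ≤ ε →
  (∀ u S → 0ℚ ≤ a u S + ε) → (∀ v T → 0ℚ ≤ b v T + ε) → ∀ i m →
  collisionWeight a b i m ≤ collisionWeight (λ u S → a u S + (ε + ε)) (λ v T → b v T + (ε + ε)) i m
collisionWeight-shift {ℓ} {n} {ε} {a} {b} 0≤ε 0≤a+ε 0≤b+ε i m =
  ∑ℚ-mono us λ u → ∑ℚ-mono us λ v → ∑ℚ-mono Ss λ S → ∑ℚ-mono Ss λ T →
  *-monoʳ-≤-nonNeg 𝟙[ i ∈ S ∩ T ] {{nonNegative (indicator-nonNeg (does (i ∈? (S ∩ T))))}}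
    (*-monoˡ-≤-nonNeg (seq (tensor ρ-disj u v) m) {{nonNegative (tensor-nonNeg u v m)}}
      (≤-by-difference ((ε + ε) * (a u S + ε + (b v T + ε)))
        (*-nonNeg (+-nonNeg 0≤ε 0≤ε) (+-nonNeg (0≤a+ε u S) (0≤b+ε v T)))
        (solve 3 (λ a b e → a :* b :+ (e :+ e) :* (a :+ e :+ (b :+ e)) := (a :+ (e :+ e)) :* (b :+ (e :+ e)))
          refl (a u S) (b v T) ε)))
  where
  us = vectors (allFin 2) ℓ
  Ss = subsets n

-- Properties that hold eventually

Eventually-× : ∀ {P Q : ℕ → Set} → Eventually P → Eventually Q → Eventually (λ m → P m × Q m)
Eventually-× (M , p) (N , q) = M ℕ.⊔ N , λ m m≥ →
  p m (ℕ.m⊔n≤o⇒m≤o M N m≥) , q m (ℕ.m⊔n≤o⇒n≤o M N m≥)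

Eventually-map : ∀ {P Q : ℕ → Set} → (∀ {m} → P m → Q m) → Eventually P → Eventually Q
Eventually-map f (N , p) = N , λ m m≥ → f (p m m≥)

-- Holds for finite types: finitely many thresholds have a maximum. It lets one index serve all
-- inputs, subsets and elements simultaneously.
EventuallyUniform : Set → Set₁
EventuallyUniform X = ∀ {P : X → ℕ → Set} → (∀ x → Eventually (P x)) → Eventually (λ m → ∀ x → P x m)

uniform-Bool : EventuallyUniform Bool
uniform-Bool p = Eventually-map (λ { (t , f) true → t ; (t , f) false → f }) (Eventually-× (p true) (p false))

uniform-Fin : ∀ n → EventuallyUniform (Fin n)
uniform-Fin zero    p = 0 , λ _ _ ()
uniform-Fin (suc n) p = Eventually-map (λ { (z , s) zero → z ; (z , s) (suc i) → s i })
  (Eventually-× (p zero) (uniform-Fin n (p ∘ suc)))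

uniform-Vec : EventuallyUniform X → ∀ n → EventuallyUniform (Vec X n)
uniform-Vec unif zero    p = Eventually-map (λ { q [] → q }) (p [])
uniform-Vec unif (suc n) p = Eventually-map (λ { q (x ∷ v) → q x v })
  (unif (λ x → uniform-Vec unif n (λ v → p (x ∷ v))))

∣p∣≤⇒≤ : ∀ {p q} → ℚ.∣ p ∣ ≤ q → p ≤ q
∣p∣≤⇒≤ {p} ∣p∣≤q with ≤-total 0ℚ p
... | inj₁ 0≤p = subst (_≤ _) (0≤p⇒∣p∣≡p 0≤p) ∣p∣≤q
... | inj₂ p≤0 = ≤-trans p≤0 (≤-trans (0≤∣p∣ p) ∣p∣≤q)

½*-pos : ∀ {p} → 0ℚ < p → 0ℚ < ½ * p
½*-pos = *-pos (toWitness {a? = 0ℚ <? ½} _)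

-- Beyond an index `N` the sequence moves by at most ε/4, so the decidable comparison of its
-- rational value at `N` with ε/2 settles the matter: a value above ε/2 would leave a gap of ε/4
-- above 0 and make `x` positive.
¬pos⇒eventually-≤ : ∀ {x} → ¬ 0ℝ <ℝ x → ∀ {ε} → 0ℚ < ε → Eventually (λ m → seq x m ≤ ε)
¬pos⇒eventually-≤ {x} x≯0 {ε} 0<ε with cauchy x η (½*-pos (½*-pos 0<ε))
  where η = ½ * (½ * ε)
... | N , close with seq x N ≤? ½ * ε
... | yes x≤ = N , λ m m≥ → begin
  seq x m                        ≡⟨ solve 2 (λ a b → a := b :+ (a :- b)) refl (seq x m) (seq x N) ⟩
  seq x N + (seq x m - seq x N)  ≤⟨ +-mono-≤ x≤ (∣p∣≤⇒≤ (close m N m≥ ℕ.≤-refl)) ⟩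
  ½ * ε + ½ * (½ * ε)            ≤⟨ ≤-by-difference (½ * (½ * ε)) (<⇒≤ (½*-pos (½*-pos 0<ε)))
             (solve 1 (λ e → con ½ :* e :+ con ½ :* (con ½ :* e) :+ con ½ :* (con ½ :* e) := e) refl ε) ⟩
  ε                              ∎
  where open ≤-Reasoning
... | no  x≰ = contradiction (mk< (½ * (½ * ε)) (½*-pos (½*-pos 0<ε)) (N , λ m m≥ → begin
  0ℚ + η
    ≡⟨ solve 1 (λ e → con 0ℚ :+ con ½ :* (con ½ :* e) := con ½ :* e :- con ½ :* (con ½ :* e)) refl ε ⟩
  ½ * ε - η
    ≤⟨ +-mono-≤ (<⇒≤ (≰⇒> x≰)) (neg-antimono-≤ (∣p∣≤⇒≤ (close N m ℕ.≤-refl m≥))) ⟩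
  seq x N - (seq x N - seq x m)  ≡⟨ solve 2 (λ a b → a :- (a :- b) := b) refl (seq x N) (seq x m) ⟩
  seq x m                        ∎)) x≯0
  where
  open ≤-Reasoning
  η = ½ * (½ * ε)

-- Were no mass positive, all would be at most `ε` at a late index, and the total there at most 1/4;
-- yet it is at least 1 - 1/2 at such an index.
distribution-nonvanishing : ∀ {n} (D : Distribution (subsets n)) → ¬ (∀ S → ¬ 0ℝ <ℝ mass D S)
distribution-nonvanishing {n} D vanishing =
  let M , ε*L≤½² = archimedean-/ L {½ * ½} (toWitness {a? = 0ℚ <? ½ * ½} _)
      ε = + 1 / suc M
      0<ε = positive⁻¹ ε {{normalize-pos 1 (suc M)}}
      N , p = Eventually-×
        (uniform-Vec uniform-Bool n (λ S → ¬pos⇒eventually-≤ {mass D S} (vanishing S) 0<ε))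
        (_≤ℝ_.eventually≤ (proj₂ (total D)) ½ (toWitness {a? = 0ℚ <? ½} _))
      small , 1≤ = p N ℕ.≤-refl
  in contradiction (begin
    1ℚ                                               ≤⟨ 1≤ ⟩
    seq (∑ (subsets n) (mass D)) N + ½               ≡⟨ cong (_+ ½) (seq-∑ (subsets n) (mass D) N) ⟩
    ∑ℚ (subsets n) (λ S → seq (mass D S) N) + ½      ≤⟨ +-monoˡ-≤ ½ (∑ℚ-mono (subsets n) small) ⟩
    ∑ℚ (subsets n) (λ _ → ε) + ½
      ≡⟨ cong (_+ ½) (trans (∑ℚ-const (subsets n) ε) (*-comm L ε)) ⟩
    ε * L + ½                                        ≤⟨ +-monoˡ-≤ ½ ε*L≤½² ⟩
    ½ * ½ + ½                                        ∎)
    (<⇒≱ (toWitness {a? = ½ * ½ + ½ <? 1ℚ} _))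
  where
  open ≤-Reasoning
  L = ι (length (subsets n))
  <⇒≱ : ∀ {p q} → p < q → ¬ q ≤ p
  <⇒≱ p<q q≤p = <-irrefl refl (<-≤-trans p<q q≤p)

-- Lower bound

≤-+ʳ : ∀ p {q} → 0ℚ ≤ q → p ≤ p + q
≤-+ʳ p {q} 0≤q = ≤-by-difference q 0≤q refl

≤-+ˡ : ∀ {p} q → 0ℚ ≤ p → q ≤ p + q
≤-+ˡ {p} q 0≤p = ≤-by-difference p 0≤p (+-comm q p)

module _ {ℓ n s : ℕ} {ε δ : ℚ} (0≤ε : 0ℚ ≤ ε) (δ≤1 : δ ≤ 1ℚ) {x : SubsetWeights ℓ n}
  -- One condition for two estimates. Shifting every weight by 2ε raises the bound on the total to 1
  -- + ε (1 + 2 L). The sets larger than `s`, with weight at most 3ε and size at most `n`, add at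
  -- most 3 ε L n to the expected size.
  (ε-small : ε * (1ℚ + ι 2 * ι (length (subsets n)) + ι (length (subsets n)) * (ι 3 * ι n)) ≤ δ)
  (x+ε≥0 : ∀ u S → 0ℚ ≤ x u S + ε)
  (∑x≤1+ε : ∀ u → ∑ℚ (subsets n) (x u) ≤ 1ℚ + ε)
  (large : ∀ u S → s ℕ.< ∣ S ∣ → x u S ≤ ε) where

  private
    L N : ℚ
    L = ι (length (subsets n))
    N = ι n

    y : SubsetWeights ℓ n
    y u S = x u S + (ε + ε)

    0≤L : 0ℚ ≤ L
    0≤L = ι-nonNeg (length (subsets n))

    0≤2L : 0ℚ ≤ ι 2 * L
    0≤2L = *-nonNeg (ι-nonNeg 2) 0≤L

    0≤3LN : 0ℚ ≤ L * (ι 3 * N)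
    0≤3LN = *-nonNeg 0≤L (*-nonNeg (ι-nonNeg 3) (ι-nonNeg n))

    y≥0 : ∀ u S → 0ℚ ≤ y u S
    y≥0 u S = subst (0ℚ ≤_) (+-assoc (x u S) ε ε) (+-nonNeg (x+ε≥0 u S) 0≤ε)

    ∑y≤2 : ∀ u → ∑ℚ (subsets n) (y u) ≤ ι 2
    ∑y≤2 u = begin
      ∑ℚ (subsets n) (y u)
        ≡⟨ ∑ℚ-+ (subsets n) (x u) (λ _ → ε + ε) ⟩
      ∑ℚ (subsets n) (x u) + ∑ℚ (subsets n) (λ _ → ε + ε)
        ≤⟨ +-mono-≤ (∑x≤1+ε u) (≤-reflexive (∑ℚ-const (subsets n) (ε + ε))) ⟩
      1ℚ + ε + L * (ε + ε)
        ≡⟨ solve 2 (λ e l → con 1ℚ :+ e :+ l :* (e :+ e) := con 1ℚ :+ e :* (con 1ℚ :+ con (ι 2) :* l)) refl ε L ⟩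
      1ℚ + ε * (1ℚ + ι 2 * L)
        ≤⟨ +-monoʳ-≤ 1ℚ (*-monoˡ-≤-nonNeg ε {{nonNegative 0≤ε}} (≤-+ʳ (1ℚ + ι 2 * L) 0≤3LN)) ⟩
      1ℚ + ε * (1ℚ + ι 2 * L + L * (ι 3 * N))
        ≤⟨ +-monoʳ-≤ 1ℚ (≤-trans ε-small δ≤1) ⟩
      ι 2                                                         ∎
      where open ≤-Reasoning

    0≤ε3N : 0ℚ ≤ ε * (ι 3 * N)
    0≤ε3N = *-nonNeg 0≤ε (*-nonNeg (ι-nonNeg 3) (ι-nonNeg n))

    -- Adding both bounds gives a single estimate valid for small and large sets, so the sum over
    -- subsets need not be split.
    size≤ : ∀ u S → y u S * ι ∣ S ∣ ≤ ι s * y u S + ε * (ι 3 * N)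
    size≤ u S with ∣ S ∣ ℕ.≤? s
    ... | yes ∣S∣≤s = begin
      y u S * ι ∣ S ∣
        ≤⟨ *-monoˡ-≤-nonNeg (y u S) {{nonNegative (y≥0 u S)}} (ι-mono-≤ ∣S∣≤s) ⟩
      y u S * ι s                      ≡⟨ *-comm (y u S) (ι s) ⟩
      ι s * y u S                      ≤⟨ ≤-+ʳ (ι s * y u S) 0≤ε3N ⟩
      ι s * y u S + ε * (ι 3 * N)      ∎
      where open ≤-Reasoning
    ... | no  ∣S∣≰s = begin
      y u S * ι ∣ S ∣                  ≤⟨ *-mono (+-nonNeg 0≤ε (+-nonNeg 0≤ε 0≤ε)) (ι-nonNeg ∣ S ∣)
                                            (+-monoˡ-≤ (ε + ε) (large u S (ℕ.≰⇒> ∣S∣≰s))) (ι-mono-≤ (∣p∣≤n S)) ⟩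
      (ε + (ε + ε)) * N
        ≡⟨ solve 2 (λ e n → (e :+ (e :+ e)) :* n := e :* (con (ι 3) :* n)) refl ε N ⟩
      ε * (ι 3 * N)                    ≤⟨ ≤-+ˡ (ε * (ι 3 * N)) (*-nonNeg (ι-nonNeg s) (y≥0 u S)) ⟩
      ι s * y u S + ε * (ι 3 * N)      ∎
      where open ≤-Reasoning

    ∑size≤ : ∀ u → ∑ℚ (subsets n) (λ S → y u S * ι ∣ S ∣) ≤ ι s * ι 2 + δ
    ∑size≤ u = begin
      ∑ℚ (subsets n) (λ S → y u S * ι ∣ S ∣)                         ≤⟨ ∑ℚ-mono (subsets n) (size≤ u) ⟩
      ∑ℚ (subsets n) (λ S → ι s * y u S + ε * (ι 3 * N))
        ≡⟨ ∑ℚ-+ (subsets n) (λ S → ι s * y u S) (λ _ → ε * (ι 3 * N)) ⟩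
      ∑ℚ (subsets n) (λ S → ι s * y u S) + ∑ℚ (subsets n) (λ _ → ε * (ι 3 * N))
        ≡⟨ cong₂ _+_ (∑ℚ-*ˡ (subsets n) (ι s) (y u)) (∑ℚ-const (subsets n) (ε * (ι 3 * N))) ⟩
      ι s * ∑ℚ (subsets n) (y u) + L * (ε * (ι 3 * N))
        ≤⟨ +-mono-≤ (*-monoˡ-≤-nonNeg (ι s) {{nonNegative (ι-nonNeg s)}} (∑y≤2 u))
             (≤-reflexive (solve 3 (λ l e n → l :* (e :* (con (ι 3) :* n)) := e :* (l :* (con (ι 3) :* n))) refl L ε N)) ⟩
      ι s * ι 2 + ε * (L * (ι 3 * N))
        ≤⟨ +-monoʳ-≤ (ι s * ι 2) (≤-trans
             (*-monoˡ-≤-nonNeg ε {{nonNegative 0≤ε}} (≤-+ˡ (L * (ι 3 * N)) (+-nonNeg 0≤1 0≤2L))) ε-small) ⟩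
      ι s * ι 2 + δ ∎
      where open ≤-Reasoning

  shifted-bounded : Bounded (ι s * ι 2 + δ) (λ u S → x u S + (ε + ε))
  shifted-bounded = record
    { nonNegative-weight = y≥0
    ; total-weight       = ∑y≤2
    ; total-size         = ∑size≤
    }

1/100 : ℚ
1/100 = + 1 / 100

-- For `s ≥ 1` the base is at most `3 s`, and 8192 ≤ 10⁴ turns the constant into the 30. For `s = 0`
-- only `δ ≤ 1/100` remains, and 8192 / 100⁴ < 1 contradicts `n ≥ 1`.
size-bound-arithmetic : ∀ {n s δ} → .{{NonZero n}} → 0ℚ < δ → δ ≤ 1/100 →
  ι n ≤ ι 8192 * ((ι s * ι 2 + δ) * (ι s * ι 2 + δ) * ((ι s * ι 2 + δ) * (ι s * ι 2 + δ))) →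
  n ℕ.≤ (30 ℕ.* s) ℕ.^ 4
size-bound-arithmetic {suc n} {zero} {δ} 0<δ δ≤ n≤ = contradiction (begin-strict
  1ℚ                                    ≤⟨ ι-mono-≤ {1} {suc n} (ℕ.s≤s ℕ.z≤n) ⟩
  ι (suc n)                             ≤⟨ n≤ ⟩
  ι 8192 * (σ * σ * (σ * σ))
    ≤⟨ *-monoˡ-≤-nonNeg (ι 8192) (*-mono 0≤c² (*-nonNeg 0≤σ 0≤σ) σ²≤ σ²≤) ⟩
  ι 8192 * (1/100 * 1/100 * (1/100 * 1/100))
    <⟨ toWitness {a? = ι 8192 * (1/100 * 1/100 * (1/100 * 1/100)) <? 1ℚ} _ ⟩
  1ℚ                                    ∎) (<-irrefl refl)
  where
  open ≤-Reasoning
  σ = ι 0 * ι 2 + δ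
  σ≡δ : σ ≡ δ
  σ≡δ = +-identityˡ δ
  0≤σ : 0ℚ ≤ σ
  0≤σ = subst (0ℚ ≤_) (sym σ≡δ) (<⇒≤ 0<δ)
  σ≤ : σ ≤ 1/100
  σ≤ = subst (_≤ 1/100) (sym σ≡δ) δ≤
  0≤c : 0ℚ ≤ 1/100
  0≤c = ≤-trans 0≤σ σ≤
  0≤c² : 0ℚ ≤ 1/100 * 1/100
  0≤c² = *-nonNeg 0≤c 0≤c
  σ²≤ : σ * σ ≤ 1/100 * 1/100
  σ²≤ = *-mono 0≤c 0≤σ σ≤ σ≤
size-bound-arithmetic {n} {suc s-1} {δ} 0<δ δ≤ n≤ = ℕ.≤-trans (ι-cancel-≤ (begin
  ι n                                   ≤⟨ n≤ ⟩
  ι 8192 * (σ * σ * (σ * σ))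
    ≤⟨ *-monoˡ-≤-nonNeg (ι 8192) (*-mono 0≤t² (*-nonNeg 0≤σ 0≤σ) σ²≤ σ²≤) ⟩
  ι 8192 * (ι t * ι t * (ι t * ι t))
    ≡⟨ cong (ι 8192 *_) (trans (cong₂ _*_ (sym (ι-* t t)) (sym (ι-* t t))) (sym (ι-* (t ℕ.* t) (t ℕ.* t)))) ⟩
  ι 8192 * ι (t ℕ.* t ℕ.* (t ℕ.* t))    ≡⟨ ι-* 8192 (t ℕ.* t ℕ.* (t ℕ.* t)) ⟨
  ι (8192 ℕ.* (t ℕ.* t ℕ.* (t ℕ.* t)))  ∎))
  (ℕ.≤-trans (ℕ.*-monoˡ-≤ (t ℕ.* t ℕ.* (t ℕ.* t)) (ℕ.≤ᵇ⇒≤ 8192 10000 _)) (ℕ.≤-reflexive (sym fourth-power)))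
  where
  open ≤-Reasoning
  s = suc s-1
  t = s ℕ.* 2 ℕ.+ s
  σ = ι s * ι 2 + δ
  0≤σ : 0ℚ ≤ σ
  0≤σ = +-nonNeg (*-nonNeg (ι-nonNeg s) (ι-nonNeg 2)) (<⇒≤ 0<δ)
  σ≤ : σ ≤ ι t
  σ≤ = subst (σ ≤_) (sym (trans (ι-+ (s ℕ.* 2) s) (cong (_+ ι s) (ι-* s 2))))
    (+-monoʳ-≤ (ι s * ι 2) (≤-trans δ≤ (≤-trans (toWitness {a? = 1/100 ≤? 1ℚ} _) (ι-mono-≤ {1} {s} (ℕ.s≤s ℕ.z≤n)))))
  0≤t² : 0ℚ ≤ ι t * ι t
  0≤t² = *-nonNeg (ι-nonNeg t) (ι-nonNeg t)
  σ²≤ : σ * σ ≤ ι t * ι t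
  σ²≤ = *-mono (ι-nonNeg t) 0≤σ σ≤ σ≤
  fourth-power : (30 ℕ.* s) ℕ.^ 4 ≡ 10000 ℕ.* (t ℕ.* t ℕ.* (t ℕ.* t))
  fourth-power = ℕ-Solver.solve 1 (λ s → (# 30 ⊗ s) ⊛ 4
    ⊜ let t = s ⊗ # 2 ⊕ s in # 10000 ⊗ (t ⊗ t ⊗ (t ⊗ t))) refl s
    where open ℕ-Solver using () renaming (con to #_; _:+_ to _⊕_; _:*_ to _⊗_; _:^_ to _⊛_; _:=_ to _⊜_)

module _ {n : ℕ} .{{_ : NonZero n}} (P : Protocol ρ-disj n (fromℚ (+ 1 / n))) (s : ℕ)
  (size≤s : ∀ k → PossibleSize P k → k ℕ.≤ s) where

  open Protocol P

  private
    -- A possible size is read off a pair of sets, so bounding one player's sets takes a possible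
    -- value of the other. `B` cannot fail to have one at any input; the all-zero word is an
    -- arbitrary choice.
    A-large : ∀ u S → s ℕ.< ∣ S ∣ → ¬ 0ℝ <ℝ mass (A u) S
    A-large u S s<∣S∣ S-pos = distribution-nonvanishing (B (replicate ℓ zero)) λ T T-pos →
      ℕ.<⇒≱ s<∣S∣ (ℕ.≤-trans (ℕ.m≤m⊔n ∣ S ∣ ∣ T ∣)
        (size≤s (∣ S ∣ ℕ.⊔ ∣ T ∣) (u , replicate ℓ zero , S , T , S-pos , T-pos , refl)))

    B-large : ∀ v T → s ℕ.< ∣ T ∣ → ¬ 0ℝ <ℝ mass (B v) T
    B-large v T s<∣T∣ T-pos = distribution-nonvanishing (A (replicate ℓ zero)) λ S S-pos →
      ℕ.<⇒≱ s<∣T∣ (ℕ.≤-trans (ℕ.m≤n⊔m ∣ S ∣ ∣ T ∣)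
        (size≤s (∣ S ∣ ℕ.⊔ ∣ T ∣) (replicate ℓ zero , v , S , T , S-pos , T-pos , refl)))

    ApproximatelyValid : ℚ → RandomisedMap (Vec (Fin 2) ℓ) n → ℕ → Set
    ApproximatelyValid ε A m = (∀ u S → 0ℚ ≤ weights A m u S + ε)
      × (∀ u → ∑ℚ (subsets n) (weights A m u) ≤ 1ℚ + ε)
      × (∀ u S → s ℕ.< ∣ S ∣ → weights A m u S ≤ ε)

    approximatelyValid : ∀ {ε} → 0ℚ < ε → ∀ A → (∀ u S → s ℕ.< ∣ S ∣ → ¬ 0ℝ <ℝ mass (A u) S) →
      Eventually (ApproximatelyValid ε A)
    approximatelyValid {ε} 0<ε A A-large = Eventually-×
      (uniform-u λ u → uniform-S λ S → _≤ℝ_.eventually≤ (nonNeg (A u) S) ε 0<ε)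
      (Eventually-×
        (uniform-u λ u → Eventually-map (λ {m} → subst (_≤ 1ℚ + ε) (seq-∑ (subsets n) (mass (A u)) m))
          (_≤ℝ_.eventually≤ (proj₁ (total (A u))) ε 0<ε))
        (uniform-u λ u → uniform-S λ S → small u S))
      where
      uniform-u : EventuallyUniform (Vec (Fin 2) ℓ)
      uniform-u = uniform-Vec (uniform-Fin 2) ℓ
      uniform-S : EventuallyUniform (Subset n)
      uniform-S = uniform-Vec uniform-Bool n
      small : ∀ u S → Eventually (λ m → s ℕ.< ∣ S ∣ → weights A m u S ≤ ε)
      small u S with s ℕ.<? ∣ S ∣
      ... | yes s<∣S∣ = Eventually-map (λ ≤ε _ → ≤ε) (¬pos⇒eventually-≤ {mass (A u) S} (A-large u S s<∣S∣) 0<ε)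
      ... | no  s≮∣S∣ = 0 , λ _ _ s<∣S∣ → contradiction s<∣S∣ s≮∣S∣

    module _ {v δ : ℚ} (0<δ : 0ℚ < δ) (δ≤½v : δ ≤ ½ * v) (δ≤1/100 : δ ≤ 1/100)
      (collision-v : ∀ i → fromℚ v ≤ℝ collisionProbability ρ-disj ℓ A B i) where

      L C : ℚ
      L = ι (length (subsets n))
      C = 1ℚ + ι 2 * L + L * (ι 3 * ι n)

      1≤C : 1ℚ ≤ C
      1≤C = ≤-trans (≤-+ʳ 1ℚ (*-nonNeg (ι-nonNeg 2) (ι-nonNeg (length (subsets n)))))
        (≤-+ʳ (1ℚ + ι 2 * L) (*-nonNeg (ι-nonNeg (length (subsets n))) (*-nonNeg (ι-nonNeg 3) (ι-nonNeg n))))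

      module _ {ε : ℚ} (0<ε : 0ℚ < ε) (εC≤δ : ε * C ≤ δ) where

        0≤ε : 0ℚ ≤ ε
        0≤ε = <⇒≤ 0<ε

        ε≤½v : ε ≤ ½ * v
        ε≤½v = ≤-trans (subst (_≤ ε * C) (*-identityʳ ε) (*-monoˡ-≤-nonNeg ε {{nonNegative 0≤ε}} 1≤C))
          (≤-trans εC≤δ δ≤½v)

        Shifted : ∀ {ℓ} → SubsetWeights ℓ n → SubsetWeights ℓ n
        Shifted x u S = x u S + (ε + ε)

        shifted-weights : ∃[ a ] ∃[ b ] Bounded {ℓ} {n} (ι s * ι 2 + δ) a × Bounded (ι s * ι 2 + δ) b
          × (∀ i → ½ * v ≤ correlation (hit a i) (hit b i))
        shifted-weights =
          let m , ev = Eventually-× (approximatelyValid 0<ε A A-large) (Eventually-×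
                (approximatelyValid 0<ε B B-large)
                (uniform-Fin n (λ i → _≤ℝ_.eventually≤ (collision-v i) ε 0<ε)))
              (a≥ , ∑a≤ , a-large) , (b≥ , ∑b≤ , b-large) , coll = ev m ℕ.≤-refl
              δ≤1 = ≤-trans δ≤1/100 (toWitness {a? = 1/100 ≤? 1ℚ} _)
          in Shifted (weights A m) , Shifted (weights B m)
           , shifted-bounded 0≤ε δ≤1 εC≤δ a≥ ∑a≤ a-large
           , shifted-bounded 0≤ε δ≤1 εC≤δ b≥ ∑b≤ b-large
           , λ i → begin
               ½ * v
                 ≡⟨ solve 1 (λ v → con ½ :* v := v :- con ½ :* v) refl v ⟩
               v - ½ * v
                 ≤⟨ +-monoʳ-≤ v (neg-antimono-≤ ε≤½v) ⟩
               v - ε                                                ≤⟨ +-monoˡ-≤ (- ε) (coll i) ⟩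
               seq (collisionProbability ρ-disj ℓ A B i) m + ε - ε
                 ≡⟨ solve 2 (λ c e → c :+ e :- e := c) refl (seq (collisionProbability ρ-disj ℓ A B i) m) ε ⟩
               seq (collisionProbability ρ-disj ℓ A B i) m
                 ≡⟨ seq-collisionProbability A B i m ⟩
               collisionWeight (weights A m) (weights B m) i m
                 ≤⟨ collisionWeight-shift {a = weights A m} {weights B m} 0≤ε a≥ b≥ i m ⟩
               collisionWeight (Shifted (weights A m)) (Shifted (weights B m)) i m
                 ≡⟨ collisionWeight-correlation (Shifted (weights A m)) (Shifted (weights B m)) i m ⟩
               correlation (hit (Shifted (weights A m)) i) (hit (Shifted (weights B m)) i) ∎
          where open ≤-Reasoning

      weights-exist : ∃[ a ] ∃[ b ] Bounded {ℓ} {n} (ι s * ι 2 + δ) a × Bounded (ι s * ι 2 + δ) b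
        × (∀ i → ½ * v ≤ correlation (hit a i) (hit b i))
      weights-exist = let M , εC≤δ = archimedean-/ C 0<δ in
        shifted-weights (positive⁻¹ (+ 1 / suc M) {{normalize-pos 1 (suc M)}}) εC≤δ

      lower-bound : 0ℚ < v → v * ι n ≡ 1ℚ → n ℕ.≤ (30 ℕ.* s) ℕ.^ 4
      lower-bound 0<v vn≡1 =
        let a , b , a-bounded , b-bounded , coll = weights-exist
        in size-bound-arithmetic {s = s} 0<δ δ≤1/100
          (weights-lower-bound (<-≤-trans 0<δ (≤-+ˡ δ (*-nonNeg (ι-nonNeg s) (ι-nonNeg 2))))
            0<v vn≡1 a-bounded b-bounded coll)

  protocol-lower-bound : n ℕ.≤ (30 ℕ.* s) ℕ.^ 4
  protocol-lower-bound = lower-bound 0<δ δ≤½v δ≤1/100 collision 0<v (1/n*ι n)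
    where
    v δ : ℚ
    v = + 1 / n
    -- Small against `½ * v`, so that half the collision probability survives the approximation, and
    -- at most 1/100 because `v ≤ 1`.
    δ = 1/100 * v

    0<v : 0ℚ < v
    0<v = positive⁻¹ v {{normalize-pos 1 n}}

    0<δ : 0ℚ < δ
    0<δ = *-pos (toWitness {a? = 0ℚ <? 1/100} _) 0<v

    δ≤½v : δ ≤ ½ * v
    δ≤½v = *-monoʳ-≤-nonNeg v {{nonNegative (<⇒≤ 0<v)}} (toWitness {a? = 1/100 ≤? ½} _)

    δ≤1/100 : δ ≤ 1/100
    δ≤1/100 = subst (δ ≤_) (*-identityʳ 1/100) (*-monoˡ-≤-nonNeg 1/100 (begin
      v         ≡⟨ *-identityʳ v ⟨
      v * ι 1   ≤⟨ *-monoˡ-≤-nonNeg v {{nonNegative (<⇒≤ 0<v)}} (ι-mono-≤ {1} {n} (ℕ.>-nonZero⁻¹ n)) ⟩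
      v * ι n   ≡⟨ 1/n*ι n ⟩
      1ℚ        ∎))
      where open ≤-Reasoning

-- Classical reasoning about maxima and infima

-- Without a maximum every element has a larger one above it, so by induction on `d` all elements
-- stay `d` below the bound; `d = b + 1` is absurd. `P` need not be decidable, hence the double
-- negation.
maximum-exists : ∀ {P : ℕ → Set} {b} → ∃ P → (∀ k → P k → k ℕ.≤ b) → ¬ ¬ ∃ (IsMaximum P)
maximum-exists {P} {b} (k₀ , p₀) bound no-max =
  ℕ.<⇒≱ (ℕ.n<1+n b) (ℕ.≤-trans (ℕ.m≤n+m (suc b) k₀) (below (suc b) k₀ p₀))
  where
  below : ∀ d k → P k → k ℕ.+ d ℕ.≤ b
  below zero    k p = subst (ℕ._≤ b) (sym (ℕ.+-identityʳ k)) (bound k p)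
  below (suc d) k p with k ℕ.+ suc d ℕ.≤? b
  ... | yes k+1+d≤b = k+1+d≤b
  ... | no  k+1+d≰b = contradiction (k , p , λ j q → ℕ.+-cancelʳ-≤ d j k
    (ℕ.≤-trans (below d j q) (ℕ.s≤s⁻¹ (subst (suc b ℕ.≤_) (ℕ.+-suc k d) (ℕ.≰⇒> k+1+d≰b))))) no-max

infimum-exists : ∀ {P : ℕ → Set} → ∃ P → ¬ ¬ ∃ (IsInfimum P)
infimum-exists {P} (k₀ , p₀) no-inf = <-rec (λ k → ¬ P k) (λ k smaller p → no-inf
  (k , (λ j q → ℕ.≮⇒≥ (λ j<k → smaller j<k q)) , λ j lower → lower k p)) k₀ p₀

-- If `m` were not in `P`, then `m + 1` would be a greater lower bound.
infimum-attained : ∀ {P : ℕ → Set} {m} → IsInfimum P m → ¬ ¬ P m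
infimum-attained {P} {m} (lower , greatest) ¬Pm = ℕ.<⇒≱ (ℕ.n<1+n m)
  (greatest (suc m) λ k p → ℕ.≤∧≢⇒< (lower k p) λ { refl → ¬Pm p })

-- Deterministic protocols

_≟ˢ_ : ∀ {n} → (S T : Subset n) → Dec (S ≡ T)
_≟ˢ_ = ≡-dec Bool._≟_

indicator-∧ : ∀ b c → indicator (b ∧ c) ≡ indicator b * indicator c
indicator-∧ true  c = sym (*-identityˡ (indicator c))
indicator-∧ false c = sym (*-zeroˡ (indicator c))

∑ℚ-delta : ∀ {n} (S : Subset n) (h : Subset n → ℚ) →
  ∑ℚ (subsets n) (λ T → indicator (does (T ≟ˢ S)) * h T) ≡ h S
∑ℚ-delta {zero} [] h = trans (+-identityʳ _) (*-identityˡ (h []))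
∑ℚ-delta {suc n} (s ∷ S) h = trans (∑ℚ-vectors (true ∷ false ∷ []) n _)
  (trans (cong₂ (λ a b → a + (b + 0ℚ)) (slice true) (slice false)) (select s))
  where
  slice : ∀ b → ∑ℚ (subsets n) (λ T → indicator (does ((b ∷ T) ≟ˢ (s ∷ S))) * h (b ∷ T))
    ≡ indicator (does (b Bool.≟ s)) * h (b ∷ S)
  slice b = trans
    (∑ℚ-cong (subsets n) λ T → trans
      (cong (_* h (b ∷ T)) (indicator-∧ (does (b Bool.≟ s)) (does (T ≟ˢ S))))
      (*-assoc (indicator (does (b Bool.≟ s))) (indicator (does (T ≟ˢ S))) (h (b ∷ T))))
    (trans (∑ℚ-*ˡ (subsets n) (indicator (does (b Bool.≟ s))) (λ T → indicator (does (T ≟ˢ S)) * h (b ∷ T)))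
      (cong (indicator (does (b Bool.≟ s)) *_) (∑ℚ-delta S (h ∘ (b ∷_)))))
  select : ∀ s → indicator (does (true Bool.≟ s)) * h (true ∷ S)
    + (indicator (does (false Bool.≟ s)) * h (false ∷ S) + 0ℚ) ≡ h (s ∷ S)
  select true  = solve 2 (λ p q → con 1ℚ :* p :+ (con 0ℚ :* q :+ con 0ℚ) := p) refl (h (true ∷ S)) (h (false ∷ S))
  select false = solve 2 (λ p q → con 0ℚ :* p :+ (con 1ℚ :* q :+ con 0ℚ) := q) refl (h (true ∷ S)) (h (false ∷ S))

seq-mono⇒≤ : ∀ {x y} → (∀ m → seq x m ≤ seq y m) → x ≤ℝ y
seq-mono⇒≤ {x} {y} x≤y = mk≤ λ ε 0<ε → 0 , λ m _ → ≤-trans (x≤y m) (≤-+ʳ (seq y m) (<⇒≤ 0<ε))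

pointMass : ∀ {n} → Subset n → Distribution (subsets n)
pointMass {n} S = record
  { mass   = δ
  ; nonNeg = λ T → seq-mono⇒≤ {0ℝ} {δ T} λ m →
      subst (0ℚ ≤_) (sym (seq-indicatorℝ (does (T ≟ˢ S)) m)) (indicator-nonNeg (does (T ≟ˢ S)))
  ; total  = seq-mono⇒≤ {∑ (subsets n) δ} {1ℝ} (λ m → ≤-reflexive (sum≡1 m))
           , seq-mono⇒≤ {1ℝ} {∑ (subsets n) δ} (λ m → ≤-reflexive (sym (sum≡1 m)))
  }
  where
  δ : Subset n → ℝ
  δ T = indicatorℝ (does (T ≟ˢ S))
  sum≡1 : ∀ m → seq (∑ (subsets n) δ) m ≡ 1ℚ
  sum≡1 m = trans (seq-∑ (subsets n) δ m) (trans
    (∑ℚ-cong (subsets n) λ T → trans (seq-indicatorℝ (does (T ≟ˢ S)) m) (sym (*-identityʳ _)))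
    (∑ℚ-delta S (λ _ → 1ℚ)))

pointMass-pos : ∀ {n} (S : Subset n) → 0ℝ <ℝ mass (pointMass S) S
pointMass-pos S with S ≟ˢ S
... | yes _   = mk< 1ℚ 0<1 (0 , λ _ _ → ≤-refl)
... | no  S≢S = contradiction refl S≢S

pointMass-support : ∀ {n} (S T : Subset n) → 0ℝ <ℝ mass (pointMass S) T → T ≡ S
pointMass-support S T pos with T ≟ˢ S
... | yes T≡S = T≡S
pointMass-support S T (mk< gap 0<gap (N , gap≤)) | no _ =
  contradiction (<-≤-trans 0<gap (≤-trans (≤-reflexive (sym (+-identityˡ gap))) (gap≤ N ℕ.≤-refl))) (<-irrefl refl)

module Deterministic {ℓ n p} (SA SB : Vec (Fin 2) ℓ → Subset n)
  (agreement : ∀ i → p ≤ correlation (λ u → 𝟙[ i ∈ SA u ]) (λ v → 𝟙[ i ∈ SB v ])) where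

  private
    A B : RandomisedMap (Vec (Fin 2) ℓ) n
    A = pointMass ∘ SA
    B = pointMass ∘ SB

    hit-pointMass : ∀ (SA : Vec (Fin 2) ℓ → Subset n) m i u → hit (weights (pointMass ∘ SA) m) i u ≡ 𝟙[ i ∈ SA u ]
    hit-pointMass SA m i u = trans
      (∑ℚ-cong (subsets n) λ T → cong (_* 𝟙[ i ∈ T ]) (seq-indicatorℝ (does (T ≟ˢ SA u)) m))
      (∑ℚ-delta (SA u) 𝟙[ i ∈_])

  protocol : Protocol ρ-disj n (fromℚ p)
  protocol = record
    { ℓ = ℓ
    ; A = A
    ; B = B
    ; collision = λ i → seq-mono⇒≤ {fromℚ p} {collisionProbability ρ-disj ℓ A B i} λ m → begin
        p
          ≤⟨ agreement i ⟩
        correlation (λ u → 𝟙[ i ∈ SA u ]) (λ v → 𝟙[ i ∈ SB v ])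
          ≡⟨ correlation-cong (hit-pointMass SA m i) (hit-pointMass SB m i) ⟨
        correlation (hit (weights A m) i) (hit (weights B m) i)
          ≡⟨ collisionWeight-correlation (weights A m) (weights B m) i m ⟨
        collisionWeight (weights A m) (weights B m) i m
          ≡⟨ seq-collisionProbability A B i m ⟨
        seq (collisionProbability ρ-disj ℓ A B i) m ∎
    }
    where open ≤-Reasoning

  possibleSize : ∃ (PossibleSize protocol)
  possibleSize = _ , o , o , SA o , SB o , pointMass-pos (SA o) , pointMass-pos (SB o) , refl
    where o = replicate ℓ zero

  possibleSize-≤ : ∀ {q} → (∀ u → ∣ SA u ∣ ℕ.≤ q) → (∀ v → ∣ SB v ∣ ℕ.≤ q) →
    ∀ k → PossibleSize protocol k → k ℕ.≤ q
  possibleSize-≤ A≤ B≤ k (u , v , S , T , S-pos , T-pos , refl) = ℕ.⊔-lub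
    (subst (λ S → ∣ S ∣ ℕ.≤ _) (sym (pointMass-support (SA u) S S-pos)) (A≤ u))
    (subst (λ T → ∣ T ∣ ℕ.≤ _) (sym (pointMass-support (SB v) T T-pos)) (B≤ v))

-- Agreeing on a symbol of a three-letter alphabet

-- Disjoint blocks of samples are independent, so correlations multiply.
correlation-⊗ : ∀ m {ℓ} (f g : Vec (Fin 2) m → ℚ) (F G : Vec (Fin 2) ℓ → ℚ) →
  correlation (λ u → f (take m u) * F (drop m u)) (λ v → g (take m v) * G (drop m v))
    ≡ correlation f g * correlation F G
correlation-⊗ zero    f g F G = correlation-* (f []) (g []) F G
correlation-⊗ (suc m) f g F G = trans
  (cong (⅓ *_) (cong₂ _+_ (cong₂ _+_
    (correlation-⊗ m f₀ g₀ F G) (correlation-⊗ m f₀ g₁ F G)) (correlation-⊗ m f₁ g₀ F G)))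
  (solve 4 (λ a b c k → con ⅓ :* (a :* k :+ b :* k :+ c :* k) := con ⅓ :* (a :+ b :+ c) :* k) refl
    (correlation f₀ g₀) (correlation f₀ g₁) (correlation f₁ g₀) (correlation F G))
  where
  f₀ = f ∘ (zero ∷_)
  f₁ = f ∘ (suc zero ∷_)
  g₀ = g ∘ (zero ∷_)
  g₁ = g ∘ (suc zero ∷_)

pattern 0F = zero
pattern 1F = suc zero
pattern 2F = suc (suc zero)

-- On the first two bits alone, symbols 0 and 1 are agreed on with probability
-- 2/9 and symbol 2 with probability 1/9.  Moving a share of the inputs 00 to
-- symbol 2, according to the last two bits, leaves 14/81 for each symbol.
alice bob : Vec (Fin 2) 4 → Fin 3
alice (0F ∷ 0F ∷ 0F ∷ 1F ∷ []) = 2F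
alice (0F ∷ 0F ∷ _)            = 0F
alice (0F ∷ 1F ∷ _)            = 1F
alice (1F ∷ 1F ∷ _)            = 1F
alice (1F ∷ 0F ∷ _)            = 2F
bob   (1F ∷ _)                 = 0F
bob   (0F ∷ 0F ∷ 1F ∷ 0F ∷ []) = 2F
bob   (0F ∷ 0F ∷ _)            = 1F
bob   (0F ∷ 1F ∷ _)            = 2F

-- Just below the exact value 14/81. It makes 6 the base of the logarithm: with 3^k words, `n` near
-- 6^k leaves about 2^k elements per word.
1/6 : ℚ
1/6 = + 1 / 6

symbolCorrelation : Fin 3 → ℚ
symbolCorrelation d =
  correlation (λ u → indicator (does (alice u Fin.≟ d))) (λ v → indicator (does (bob v Fin.≟ d)))

symbol-agreement : ∀ d → 1/6 ≤ symbolCorrelation d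
symbol-agreement 0F = toWitness {a? = 1/6 ≤? symbolCorrelation 0F} _
symbol-agreement 1F = toWitness {a? = 1/6 ≤? symbolCorrelation 1F} _
symbol-agreement 2F = toWitness {a? = 1/6 ≤? symbolCorrelation 2F} _

_≟ʷ_ : ∀ {k} → (w w′ : Vec (Fin 3) k) → Dec (w ≡ w′)
_≟ʷ_ = ≡-dec Fin._≟_

blockwise : (Vec (Fin 2) 4 → Fin 3) → ∀ k → Vec (Fin 2) (k ℕ.* 4) → Vec (Fin 3) k
blockwise f zero    u = []
blockwise f (suc k) u = f (take 4 u) ∷ blockwise f k (drop 4 u)

powers-of-1/6 : ℕ → ℚ
powers-of-1/6 zero    = 1ℚ
powers-of-1/6 (suc k) = 1/6 * powers-of-1/6 k

0≤1/6 : 0ℚ ≤ 1/6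
0≤1/6 = toWitness {a? = 0ℚ ≤? 1/6} _

powers-nonNeg : ∀ k → 0ℚ ≤ powers-of-1/6 k
powers-nonNeg zero    = 0≤1
powers-nonNeg (suc k) = *-nonNeg 0≤1/6 (powers-nonNeg k)

word-agreement : ∀ k w → powers-of-1/6 k ≤ correlation
  (λ u → indicator (does (blockwise alice k u ≟ʷ w))) (λ v → indicator (does (blockwise bob k v ≟ʷ w)))
word-agreement zero    []      = ≤-refl
word-agreement (suc k) (d ∷ w) = begin
  1/6 * powers-of-1/6 k
    ≤⟨ *-mono (≤-trans 0≤1/6 (symbol-agreement d)) (powers-nonNeg k) (symbol-agreement d) (word-agreement k w) ⟩
  correlation (is d alice) (is d bob) * correlation (is-word w alice) (is-word w bob)
    ≡⟨ correlation-⊗ 4 (is d alice) (is d bob) (is-word w alice) (is-word w bob) ⟨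
  correlation (λ u → is d alice (take 4 u) * is-word w alice (drop 4 u))
    (λ v → is d bob (take 4 v) * is-word w bob (drop 4 v))
    ≡⟨ correlation-cong (split alice) (split bob) ⟨
  correlation (λ u → indicator (does (blockwise alice (suc k) u ≟ʷ (d ∷ w))))
    (λ v → indicator (does (blockwise bob (suc k) v ≟ʷ (d ∷ w)))) ∎
  where
  open ≤-Reasoning
  is : Fin 3 → (Vec (Fin 2) 4 → Fin 3) → Vec (Fin 2) 4 → ℚ
  is d f u = indicator (does (f u Fin.≟ d))
  is-word : Vec (Fin 3) k → (Vec (Fin 2) 4 → Fin 3) → Vec (Fin 2) (k ℕ.* 4) → ℚ
  is-word w f u = indicator (does (blockwise f k u ≟ʷ w))
  split : ∀ f u → indicator (does (blockwise f (suc k) u ≟ʷ (d ∷ w)))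
    ≡ is d f (take 4 u) * is-word w f (drop 4 u)
  split f u = indicator-∧ (does (f (take 4 u) Fin.≟ d)) (does (blockwise f k (drop 4 u) ≟ʷ w))

-- Upper bound

-- Induction along `S`: when the head belongs to `S`, its image is punched out of `Fin q`, which
-- leaves one value fewer for the tail.
∣S∣≤-injection : ∀ {n q} (S : Subset n) (φ : ∀ i → i ∈ S → Fin q) →
  (∀ {i j} (i∈S : i ∈ S) (j∈S : j ∈ S) → φ i i∈S ≡ φ j j∈S → i ≡ j) → ∣ S ∣ ℕ.≤ q
∣S∣≤-injection []          φ inj = ℕ.z≤n
∣S∣≤-injection (false ∷ S) φ inj =
  ∣S∣≤-injection S (λ i i∈S → φ (suc i) (there i∈S))
    (λ i∈S j∈S eq → Fin.suc-injective (inj (there i∈S) (there j∈S) eq))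
∣S∣≤-injection {q = zero}  (true ∷ S) φ inj with () ← φ zero here
∣S∣≤-injection {q = suc q} (true ∷ S) φ inj = ℕ.s≤s
  (∣S∣≤-injection S (λ i i∈S → punchOut (distinct i∈S))
    (λ i∈S j∈S eq → Fin.suc-injective (inj (there i∈S) (there j∈S)
      (Fin.punchOut-injective (distinct i∈S) (distinct j∈S) eq))))
  where
  distinct : ∀ {i} (i∈S : i ∈ S) → φ zero here ≢ φ (suc i) (there i∈S)
  distinct i∈S eq with () ← inj here (there i∈S) eq

remQuot-injective : ∀ {m} n {i j : Fin (m ℕ.* n)} →
  quotient {m} n i ≡ quotient {m} n j → remainder {m} n i ≡ remainder {m} n j → i ≡ j
remQuot-injective {m} n {i} {j} q≡ r≡ = trans (sym (Fin.combine-remQuot {m} n i))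
  (trans (cong₂ combine q≡ r≡) (Fin.combine-remQuot {m} n j))

digits : ∀ k → Fin (3 ℕ.^ k) → Vec (Fin 3) k
digits zero    i = []
digits (suc k) i = quotient (3 ℕ.^ k) i ∷ digits k (remainder {3} (3 ℕ.^ k) i)

digits-injective : ∀ k {i j} → digits k i ≡ digits k j → i ≡ j
digits-injective zero    {0F} {0F} _ = refl
digits-injective (suc k) eq = let d≡ , ds≡ = ∷-injective eq in
  remQuot-injective {3} (3 ℕ.^ k) d≡ (digits-injective k ds≡)

𝟙-tabulate : ∀ {n} i (p : Fin n → Bool) → 𝟙[ i ∈ Vec.tabulate p ] ≡ indicator (p i)
𝟙-tabulate zero p with p zero
... | true  = refl
... | false = refl
𝟙-tabulate (suc i) p = trans (𝟙-suc (p zero) i (Vec.tabulate (p ∘ suc))) (𝟙-tabulate i (p ∘ suc))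

∈-tabulate⁻ : ∀ {n} {i} {p : Fin n → Bool} → i ∈ Vec.tabulate p → p i ≡ true
∈-tabulate⁻ {i = i} {p} i∈ = trans (sym (lookup∘tabulate p i)) ([]=⇒lookup i∈)

module _ {n k q : ℕ} (n≤ : n ℕ.≤ 3 ℕ.^ k ℕ.* q) where

  -- `[n]` embeds into pairs of a word and a slot. A fibre fixes the word, so `slot` is injective on
  -- it.
  label : Fin n → Vec (Fin 3) k
  label i = digits k (quotient q (inject≤ i n≤))

  slot : Fin n → Fin q
  slot i = remainder {3 ℕ.^ k} q (inject≤ i n≤)

  fibre : Vec (Fin 3) k → Subset n
  fibre w = Vec.tabulate (λ i → does (w ≟ʷ label i))

  ∣fibre∣≤ : ∀ w → ∣ fibre w ∣ ℕ.≤ q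
  ∣fibre∣≤ w = ∣S∣≤-injection (fibre w) (λ i _ → slot i) λ {i} {j} i∈ j∈ eq →
    Fin.inject≤-injective n≤ n≤ i j (remQuot-injective {3 ℕ.^ k} q
      (digits-injective k (trans (sym (member i∈)) (member j∈))) eq)
    where
    member : ∀ {i} → i ∈ fibre w → w ≡ label i
    member {i} i∈ with w ≟ʷ label i | ∈-tabulate⁻ {p = λ i → does (w ≟ʷ label i)} i∈
    ... | yes w≡ | _ = w≡

  𝟙-fibre : ∀ i w → 𝟙[ i ∈ fibre w ] ≡ indicator (does (w ≟ʷ label i))
  𝟙-fibre i w = 𝟙-tabulate i (λ i → does (w ≟ʷ label i))

-- Choosing the word length

6^k*powers : ∀ k → ι (6 ℕ.^ k) * powers-of-1/6 k ≡ 1ℚ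
6^k*powers zero    = refl
6^k*powers (suc k) = trans (cong (_* (1/6 * powers-of-1/6 k)) (ι-* 6 (6 ℕ.^ k)))
  (trans (solve 2 (λ a b → con (ι 6) :* a :* (con 1/6 :* b) := a :* b) refl (ι (6 ℕ.^ k)) (powers-of-1/6 k))
    (6^k*powers k))

1/n≤powers : ∀ {n} .{{_ : NonZero n}} k → 6 ℕ.^ k ℕ.≤ n → + 1 / n ≤ powers-of-1/6 k
1/n≤powers {n} k 6^k≤n = begin
  v                       ≡⟨ trans (cong (v *_) (6^k*powers k)) (*-identityʳ v) ⟨
  v * (ι (6 ℕ.^ k) * P)
    ≤⟨ *-monoˡ-≤-nonNeg v {{normalize-nonNeg 1 n}}
         (*-monoʳ-≤-nonNeg P {{nonNegative (powers-nonNeg k)}} (ι-mono-≤ 6^k≤n)) ⟩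
  v * (ι n * P)           ≡⟨ *-assoc v (ι n) P ⟨
  v * ι n * P             ≡⟨ trans (cong (_* P) (1/n*ι n)) (*-identityˡ P) ⟩
  P                       ∎
  where
  open ≤-Reasoning
  v = + 1 / n
  P = powers-of-1/6 k

power-below : ∀ n .{{_ : NonZero n}} → ∃[ k ] 6 ℕ.^ k ℕ.≤ n × n ℕ.< 6 ℕ.^ suc k
power-below 1 = 0 , ℕ.s≤s ℕ.z≤n , ℕ.s≤s (ℕ.s≤s ℕ.z≤n)
power-below (suc (suc n)) with power-below (suc n)
... | k , lower , upper with suc (suc n) ℕ.<? 6 ℕ.^ suc k
... | yes upper′ = k , ℕ.m≤n⇒m≤1+n lower , upper′
... | no  ≮6^1+k = suc k , ℕ.≮⇒≥ ≮6^1+k , ℕ.≤-<-trans upper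
  (ℕ.m<m*n (6 ℕ.^ suc k) 6 {{ℕ.m^n≢0 6 (suc k)}} (ℕ.s≤s (ℕ.s≤s ℕ.z≤n)) ▹ ℕ.*-comm (6 ℕ.^ suc k) 6)
  where
  _▹_ : ∀ {a b c} → a ℕ.< b → b ≡ c → a ℕ.< c
  a<b ▹ refl = a<b

^-distribʳ-* : ∀ a b k → (a ℕ.* b) ℕ.^ k ≡ a ℕ.^ k ℕ.* b ℕ.^ k
^-distribʳ-* a b zero    = refl
^-distribʳ-* a b (suc k) = trans (cong (a ℕ.* b ℕ.*_) (^-distribʳ-* a b k))
  (ℕ.[m*n]*[o*p]≡[m*o]*[n*p] a b (a ℕ.^ k) (b ℕ.^ k))

-- Bounds the possible sizes instead of naming their maximum, which is available only under double
-- negation.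
SmallProtocol : (n : ℕ) → .{{NonZero n}} → ℕ → Set
SmallProtocol n s = ∃[ P ] ∃ (PossibleSize {ρ = ρ-disj} {n} {fromℚ (+ 1 / n)} P)
  × (∀ j → PossibleSize P j → j ℕ.≤ s)

-- `6 * 2^k` slots per word suffice because n < 6^(k+1) = 3^k · 6 · 2^k.
smallProtocol : ∀ n .{{_ : NonZero n}} → ∃[ k ] 6 ℕ.^ k ℕ.≤ n × SmallProtocol n (6 ℕ.* 2 ℕ.^ k)
smallProtocol n =
  let k , 6^k≤n , n<6^1+k = power-below n
      open Construction k 6^k≤n n<6^1+k
  in k , 6^k≤n , protocol , possibleSize ,
     possibleSize-≤ (λ u → ∣fibre∣≤ n≤ (blockwise alice k u)) (λ v → ∣fibre∣≤ n≤ (blockwise bob k v))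
  where
  module Construction k (6^k≤n : 6 ℕ.^ k ℕ.≤ n) (n<6^1+k : n ℕ.< 6 ℕ.^ suc k) where
    n≤ : n ℕ.≤ 3 ℕ.^ k ℕ.* (6 ℕ.* 2 ℕ.^ k)
    n≤ = ℕ.≤-trans (ℕ.<⇒≤ n<6^1+k) (ℕ.≤-reflexive (begin
      6 ℕ.* 6 ℕ.^ k                   ≡⟨ cong (6 ℕ.*_) (^-distribʳ-* 3 2 k) ⟩
      6 ℕ.* (3 ℕ.^ k ℕ.* 2 ℕ.^ k)     ≡⟨ x∙yz≈y∙xz 6 (3 ℕ.^ k) (2 ℕ.^ k) ⟩
      3 ℕ.^ k ℕ.* (6 ℕ.* 2 ℕ.^ k)     ∎))
      where
      open ≡-Reasoning
      open import Algebra.Properties.CommutativeSemigroup ℕ.*-commutativeSemigroup using (x∙yz≈y∙xz)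
    open Deterministic {k ℕ.* 4} {n} {+ 1 / n} (fibre n≤ ∘ blockwise alice k) (fibre n≤ ∘ blockwise bob k) (λ i →
      ≤-trans (1/n≤powers k 6^k≤n) (≤-trans (word-agreement k (label n≤ i)) (≤-reflexive (sym (correlation-cong
        (λ u → 𝟙-fibre n≤ i (blockwise alice k u)) (λ v → 𝟙-fibre n≤ i (blockwise bob k v))))))) public

-- Asymptotics

module _ {n : ℕ} .{{_ : NonZero n}} where

  ProtocolOfSize : ℕ → Set
  ProtocolOfSize s = ∃[ P ] OutputSize {ρ = ρ-disj} {n} {fromℚ (+ 1 / n)} P s

  protocolOfSize-exists : ¬ ¬ ∃ ProtocolOfSize
  protocolOfSize-exists none = let k , 6^k≤n , P , possible , bounded = smallProtocol n in
    maximum-exists possible bounded λ { (s , size) → none (s , P , size) }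

  col-exists : ¬ ¬ ∃ (col-disj n)
  col-exists none = protocolOfSize-exists λ p → infimum-exists p none

  -- The protocol's output size exists only under double negation, but comparison of naturals is
  -- decidable, so the bound can still be extracted.
  col-≤ : ∀ {c s} → col-disj n c → SmallProtocol n s → c ℕ.≤ s
  col-≤ {c} {s} (lower , _) (P , possible , bounded) = decidable-stable (c ℕ.≤? s) λ c≰s →
    maximum-exists possible bounded λ { (t , size) →
      c≰s (ℕ.≤-trans (lower t (P , size)) (bounded t (proj₁ size))) }

  n≤[30c]⁴ : ∀ {c} → col-disj n c → n ℕ.≤ (30 ℕ.* c) ℕ.^ 4
  n≤[30c]⁴ {c} col = decidable-stable (n ℕ.≤? (30 ℕ.* c) ℕ.^ 4) λ n≰ →
    infimum-attained col λ { (P , _ , maximal) → n≰ (protocol-lower-bound P c maximal) }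

^-swap : ∀ a b c → (a ℕ.^ b) ℕ.^ c ≡ (a ℕ.^ c) ℕ.^ b
^-swap a b c = trans (ℕ.^-*-assoc a b c) (trans (cong (a ℕ.^_) (ℕ.*-comm b c)) (sym (ℕ.^-*-assoc a c b)))

-- Exchanging the exponents `k` and `q` in `(2^k)^q` lets `2^q ≤ 6^p` be raised to the power `k`,
-- after which `6^k ≤ n` applies.
isO-log : IsO col-disj (log 6 2)
isO-log = 6 , 0 , λ n _ c col p q 2^q≤6^p →
  let k , 6^k≤n , small = smallProtocol n
      open ℕ.≤-Reasoning
  in begin
    c ℕ.^ q                            ≤⟨ ℕ.^-monoˡ-≤ q (col-≤ col small) ⟩
    (6 ℕ.* 2 ℕ.^ k) ℕ.^ q              ≡⟨ ^-distribʳ-* 6 (2 ℕ.^ k) q ⟩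
    6 ℕ.^ q ℕ.* (2 ℕ.^ k) ℕ.^ q        ≡⟨ cong (6 ℕ.^ q ℕ.*_) (^-swap 2 k q) ⟩
    6 ℕ.^ q ℕ.* (2 ℕ.^ q) ℕ.^ k        ≤⟨ ℕ.*-monoʳ-≤ (6 ℕ.^ q) (ℕ.^-monoˡ-≤ k 2^q≤6^p) ⟩
    6 ℕ.^ q ℕ.* (6 ℕ.^ p) ℕ.^ k        ≡⟨ cong (6 ℕ.^ q ℕ.*_) (^-swap 6 p k) ⟩
    6 ℕ.^ q ℕ.* (6 ℕ.^ k) ℕ.^ p        ≤⟨ ℕ.*-monoʳ-≤ (6 ℕ.^ q) (ℕ.^-monoˡ-≤ p 6^k≤n) ⟩
    6 ℕ.^ q ℕ.* n ℕ.^ p                ∎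

-- The hypothesis says log_b x ≤ r/s, so fractions above r/s lie above the logarithm, and a bound
-- O(n^log_b x) passes to r/s. A failure is refuted by raising it to the power `r`.
log-above : ∀ {b x r s} .{{_ : NonZero b}} .{{_ : NonZero r}} → x ℕ.^ s ℕ.≤ b ℕ.^ r →
  ∀ p q → r ℕ.* q ℕ.≤ p ℕ.* s → .{{NonZero x}} → x ℕ.^ q ℕ.≤ b ℕ.^ p
log-above {b} {x} {r} {s} x^s≤b^r p q rq≤ps = ℕ.≮⇒≥ λ b^p<x^q → ℕ.<⇒≱ (ℕ.^-monoˡ-< r b^p<x^q) (begin
  (x ℕ.^ q) ℕ.^ r    ≡⟨ trans (^-swap x q r) (ℕ.^-*-assoc x r q) ⟩
  x ℕ.^ (r ℕ.* q)    ≤⟨ ℕ.^-monoʳ-≤ x rq≤ps ⟩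
  x ℕ.^ (p ℕ.* s)    ≡⟨ trans (sym (ℕ.^-*-assoc x p s)) (^-swap x p s) ⟩
  (x ℕ.^ s) ℕ.^ p    ≤⟨ ℕ.^-monoˡ-≤ p x^s≤b^r ⟩
  (b ℕ.^ r) ℕ.^ p    ≡⟨ ^-swap b r p ⟩
  (b ℕ.^ p) ℕ.^ r    ∎)
  where open ℕ.≤-Reasoning

-- log_6 2 = 0.38685..., just below 0.387.
2^1000≤6^387 : 2 ℕ.^ 1000 ℕ.≤ 6 ℕ.^ 387
2^1000≤6^387 = ℕ.≤ᵇ⇒≤ (2 ℕ.^ 1000) (6 ℕ.^ 387) _

isO-387/1000 : IsO col-disj (387 // 1000)
isO-387/1000 = let K , n₀ , bound = isO-log in K , n₀ , λ n n₀≤n c col p q above →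
  bound n n₀≤n c col p q (log-above {6} {2} {387} {1000} 2^1000≤6^387 p q above)

-- Stated for every `α` whose lower fractions are at most 1/4, so that it covers both `1 // 4` and
-- `25 // 100`, which are distinct as `Exponent`s.
isΩ : ∀ α → (∀ p q .{{_ : NonZero q}} → Below α p q → p ℕ.* 4 ℕ.≤ q) → IsΩ col-disj α
isΩ α 4p≤q = 30 , 0 , λ n _ c col p q below → bound n c p q (n≤[30c]⁴ col) (4p≤q p q below)
  where
  bound : ∀ n .{{_ : NonZero n}} c p q → n ℕ.≤ (30 ℕ.* c) ℕ.^ 4 → p ℕ.* 4 ℕ.≤ q → n ℕ.^ p ℕ.≤ (30 ℕ.* c) ℕ.^ q
  -- `c = 0` is impossible for `n ≥ 1`; the other clause needs a positive base for monotonicity in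
  -- the exponent.
  bound (suc n) zero    p q () 4p≤q
  bound n       (suc c) p q n≤ 4p≤q = begin
    n ℕ.^ p                  ≤⟨ ℕ.^-monoˡ-≤ p n≤ ⟩
    (m ℕ.^ 4) ℕ.^ p          ≡⟨ trans (^-swap m 4 p) (ℕ.^-*-assoc m p 4) ⟩
    m ℕ.^ (p ℕ.* 4)          ≤⟨ ℕ.^-monoʳ-≤ m 4p≤q ⟩
    m ℕ.^ q                  ∎
    where
    open ℕ.≤-Reasoning
    m = 30 ℕ.* suc c

-- Both asymptotic bounds speak only of values `c` with `col-disj n c`; the first conjunct keeps
-- them from being vacuous.
propositionA5 : (∀ n .{{_ : NonZero n}} → ¬ ¬ ∃ (col-disj n))
    × (IsO col-disj (log 6 2) × IsΩ col-disj (1 // 4))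
    × (IsO col-disj (387 // 1000) × IsΩ col-disj (25 // 100))
propositionA5 = (λ n → col-exists)
  , (isO-log , isΩ (1 // 4) λ p q 4p≤1q → subst (p ℕ.* 4 ℕ.≤_) (ℕ.*-identityˡ q) 4p≤1q)
  , (isO-387/1000 , isΩ (25 // 100) λ p q 100p≤25q → ℕ.*-cancelˡ-≤ 25 (subst (ℕ._≤ 25 ℕ.* q) (rescale p) 100p≤25q))
  where
  rescale : ∀ p → p ℕ.* 100 ≡ 25 ℕ.* (p ℕ.* 4)
  rescale p = trans (sym (ℕ.*-assoc p 4 25)) (ℕ.*-comm (p ℕ.* 4) 25)
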